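{- Let $q=p^h$, $p$ prime, $n\ge3$, $1\le k\le n-1$. If $c$ is a codeword of $C_k(n,q)^\perp$ of minimal weight, then $supp(c)$ is contained in an $(n-k+1)$-dimensional subspace of $PG(n,q)$.
   Context: $C_k(n,q)$ is the $p$-ary linear code spanned over $\mathbb{F}_p$ by the rows of the incidence matrix of $k$-dimensional subspaces versus points of $PG(n,q)$; $C_k(n,q)^\perp$ is its dual code with respect to the standard scalar product. $supp(c)$ is the set of points at which $c$ has a nonzero coordinate; minimal weight means minimal among nonzero codewords. -}

module Defs where

open import Level using (0ℓ)
open import Data.Bool using (Bool; true; false; not; if_then_else_)
open import Data.Nat using (ℕ; zero; suc; _+_; _≤_; _≡ᵇ_)
open import Data.Fin using (Fin; zero; suc; toℕ)
open import Data.List using (List; []; _∷_; map; concatMap; filterᵇ; length)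
open import Data.Bool.ListAction using (any)
open import Data.Nat.ListAction using (sum)
open import Data.Nat.Divisibility using (_∣_)
open import Data.List.Membership.Propositional using (_∈_)
open import Data.List.Relation.Unary.Unique.Propositional using (Unique)
open import Data.Product using (Σ; ∃; _×_; _,_)
open import Data.Vec.Functional using (Vector) renaming (_∷_ to _∷ᵥ_)
open import Relation.Binary.PropositionalEquality using (_≡_; _≢_)
open import Relation.Binary.Definitions using (DecidableEquality)
open import Relation.Nullary using (does)
open import Algebra.Structures using (IsCommutativeRing)

record FiniteField : Set₁ where
  field
    Carrier  : Set
    _+F_     : Carrier → Carrier → Carrier
    _*F_     : Carrier → Carrier → Carrier
    -F_      : Carrier → Carrier
    0F       : Carrier
    1F       : Carrier
    isCommutativeRing : IsCommutativeRing _≡_ _+F_ _*F_ -F_ 0F 1F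
    0≢1      : 0F ≢ 1F
    inverse  : ∀ x → x ≢ 0F → Σ Carrier (λ y → x *F y ≡ 1F)
    _≟F_     : DecidableEquality Carrier
    elements : List Carrier
    complete : ∀ x → x ∈ elements
    unique   : Unique elements

  order : ℕ
  order = length elements

module Geometry (F : FiniteField) where
  open FiniteField F

  Vec' : ℕ → Set
  Vec' m = Vector Carrier m

  allVecs : ∀ m → List (Vec' m)
  allVecs zero    = (λ ()) ∷ []
  allVecs (suc m) = concatMap (λ x → map (λ v → x ∷ᵥ v) (allVecs m)) elements

  eqVec : ∀ {m} → Vec' m → Vec' m → Bool
  eqVec {zero}  u v = true
  eqVec {suc m} u v with does (u zero ≟F v zero)
  ... | true  = eqVec {m} (λ i → u (suc i)) (λ i → v (suc i))
  ... | false = false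

  -- "normalized" vector: nonzero, and its first nonzero coordinate is 1.
  -- Normalized vectors of F^(n+1) are the canonical representatives of the
  -- points of PG(n,q).
  isNormalized : ∀ {m} → Vec' m → Bool
  isNormalized {zero}  v = false
  isNormalized {suc m} v with does (v zero ≟F 0F)
  ... | true  = isNormalized {m} (λ i → v (suc i))
  ... | false = does (v zero ≟F 1F)

  points : ∀ n → List (Vec' (suc n))
  points n = filterᵇ isNormalized (allVecs (suc n))

  sumF : ∀ {r} → Vector Carrier r → Carrier
  sumF {zero}  a = 0F
  sumF {suc r} a = a zero +F sumF (λ i → a (suc i))

  lincomb : ∀ {r m} → Vector Carrier r → Vector (Vec' m) r → Vec' m
  lincomb a vs j = sumF (λ i → a i *F vs i j)

  LinIndep : ∀ {r m} → Vector (Vec' m) r → Set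
  LinIndep vs = ∀ a → (∀ j → lincomb a vs j ≡ 0F) → ∀ i → a i ≡ 0F

  inSpan : ∀ {r m} → Vector (Vec' m) r → Vec' m → Bool
  inSpan {r} vs P = any (λ a → eqVec P (lincomb a vs)) (allVecs r)

  -- A k-dimensional (projective) subspace of PG(n,q) is the span of
  -- k+1 linearly independent vectors of F^(n+1).
  ProjSubspace : ℕ → ℕ → Set
  ProjSubspace n k = Σ (Vector (Vec' (suc n)) (suc k)) LinIndep

  -- codewords of the p-ary code: functions from points to F_p
  -- (only the values at normalized vectors, i.e. at points, matter)
  Word : ℕ → ℕ → Set
  Word p n = Vec' (suc n) → Fin p

  -- standard scalar product (as a natural number; its residue mod p is
  -- the F_p value) of a word with the incidence vector of a subspace
  incProduct : ∀ {p n k} → Word p n → ProjSubspace n k → ℕ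
  incProduct {p} {n} c (vs , _) =
    sum (map (λ P → if inSpan vs P then toℕ (c P) else 0) (points n))

  -- c ∈ C_k(n,q)^⊥ : orthogonal (over F_p) to all generators of C_k(n,q)
  InDual : (p n k : ℕ) → Word p n → Set
  InDual p n k c = ∀ (S : ProjSubspace n k) → p ∣ incProduct c S

  nonzeroAt : ∀ {p} → Fin p → Bool
  nonzeroAt x = not (toℕ x ≡ᵇ 0)

  InSupp : ∀ {p n} → Word p n → Vec' (suc n) → Set
  InSupp {p} {n} c P = P ∈ points n × toℕ (c P) ≢ 0

  NonzeroWord : ∀ {p n} → Word p n → Set
  NonzeroWord {p} {n} c = Σ (Vec' (suc n)) (InSupp c)

  weight : ∀ {p n} → Word p n → ℕ
  weight {p} {n} c = length (filterᵇ (λ P → nonzeroAt (c P)) (points n))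

  MinWeightDual : (p n k : ℕ) → Word p n → Set
  MinWeightDual p n k c =
    InDual p n k c × NonzeroWord c ×
    (∀ (c' : Word p n) → InDual p n k c' → NonzeroWord c' → weight c ≤ weight c')

{-# OPTIONS --safe #-}
module Submission where

-- Extend a codeword c of C_k(n,q)^⊥ to a function on F^(n+1) that is constant on the nonzero
-- multiples of each vector. As q ≡ 0 mod p, duality means that this function sums to 0 mod p
-- over every (k+1)-dimensional linear subspace. Projecting a codeword from a point R onto a
-- hyperplane H (add up the values on each line RX, X ∈ H) again gives a codeword.
--
-- Let c have minimal weight and let its support S span W, and suppose that W is too large. If R ∉ S lies
-- on a secant of S, then the projection from R has smaller weight than c, so it is zero: all lines
-- through R have sum 0. Hence the union of S and its secants is closed under joining with
-- points of S, so it is all of W. Now the projection from R ∈ S has smaller weight too, because every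
-- line through R and a point X ∉ S of W has another point in S. So every line of W has sum 0,
-- and the restriction of c to a hyperplane of W is still a codeword; if the hyperplane meets
-- S without containing it, this restriction has smaller weight, a contradiction.

open import Defs
open import Data.Bool.Base using (Bool; T; if_then_else_)
open import Data.Bool.Properties using (T-≡)
open import Data.Nat hiding (_≟_)
import Data.Nat.Properties as ℕₚ
open import Data.Nat.DivMod using (_%_; _/_; m≡m%n+[m/n]*n; m%n<n)
open import Data.Nat.Divisibility
open import Data.Nat.ListAction using (sum)
open import Data.Nat.ListAction.Properties using (sum-++)
open import Data.Nat.Primality using (Prime; prime⇒nonZero)
open import Data.Bool using (true; false)
open import Data.Fin using (Fin; zero; suc; toℕ; fromℕ<)
open import Data.Fin.Properties using (toℕ-fromℕ<; toℕ<n)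
open import Data.List.Base using (List; []; _∷_; map; concatMap; filterᵇ; length; _++_)
open import Data.List.Properties using (map-++; map-∘; map-concatMap; concatMap-cong)
open import Data.List.Membership.Propositional using (_∈_; find; lose)
open import Data.List.Membership.Propositional.Properties
  using (∈-concatMap⁺; ∈-map⁺; ∈-map⁻; ∈-filter⁺; ∈-filter⁻)
import Data.List.Relation.Unary.All as All
open import Data.List.Relation.Unary.AllPairs using (_∷_)
open import Data.List.Relation.Unary.Any using (here; there; any?)
open import Data.List.Relation.Unary.Any.Properties using (any⁺; any⁻)
open import Data.List.Relation.Unary.Unique.Propositional using (Unique)
open import Data.Vec.Base using (Vec; []; _∷_; head; tail; lookup; tabulate; zipWith; replicate) renaming (map to mapV)
import Data.Vec.Properties as Vecₚ
open import Data.Vec.Functional using () renaming (_∷_ to _∷ᵥ_)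
open import Data.Vec.Relation.Unary.All as VAll using ([]; _∷_) renaming (All to VecAll)
open import Data.Product using (Σ; ∃; _×_; _,_; proj₁; proj₂)
open import Data.Sum.Base using (_⊎_; inj₁; inj₂)
open import Data.Unit.Base using (⊤; tt)
open import Data.Empty using (⊥; ⊥-elim)
open import Function.Base using (_∘_; id)
open import Function.Bundles using (Equivalence)
open import Relation.Nullary using (Dec; yes; no; ¬_; does)
open import Relation.Nullary.Decidable using (map′; _×-dec_; ¬?; decidable-stable; T?; dec-true)
open import Relation.Binary.Definitions using (DecidableEquality)
open import Relation.Binary.PropositionalEquality
  using (_≡_; _≢_; refl; sym; trans; cong; cong₂; subst; module ≡-Reasoning)
open import Algebra.Bundles using (CommutativeRing)
import Algebra.Properties.Ring
import Algebra.Properties.CommutativeSemigroup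
open import Algebra.Properties.CommutativeSemigroup ℕₚ.+-commutativeSemigroup using (interchange)

-- What "too large" means is dictated by the last step. Let W have codimension e in F^(n+1). A
-- hyperplane of W has codimension e + 1, so a (k+1)-dimensional linear subspace meets it in
-- dimension at least k - e. The sums known to vanish are those over lines of W, which have linear
-- dimension 2; so the restriction is a codeword once e ≤ k - 2, that is, once W has projective
-- dimension greater than n - k + 1. A line joining R ∈ S to a point outside W has sum c(R), which
-- would make the projection heavy. So the contribution of R is counted only on lines inside W. The
-- result is still a codeword, because the indicator function of W sums to 0 mod p over every linear
-- subspace of dimension greater than e. Sums over a subspace are taken over all linear combinations
-- of a spanning tuple. A dependent tuple hits every vector a multiple of q times and so gives 0 mod
-- p; hence no independence has to be maintained while tuples are built.

private
  variable
    I J Φ Ψ : Set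

-- Finite sums of natural numbers with decidable guards.

infixr 7 _⊙_

_⊙_ : Dec Φ → ℕ → ℕ
yes _ ⊙ n = n
no _  ⊙ n = 0

⊙-yes : (d : Dec Φ) → Φ → ∀ n → d ⊙ n ≡ n
⊙-yes (yes _) p n = refl
⊙-yes (no ¬p) p n = ⊥-elim (¬p p)

⊙-no : (d : Dec Φ) → ¬ Φ → ∀ n → d ⊙ n ≡ 0
⊙-no (yes p) ¬p n = ⊥-elim (¬p p)
⊙-no (no _) ¬p n = refl

⊙-cong : (d : Dec Φ) (e : Dec Ψ) → (Φ → Ψ) → (Ψ → Φ) → ∀ {m n} → m ≡ n → d ⊙ m ≡ e ⊙ n
⊙-cong (yes p) e to from refl = sym (⊙-yes e (to p) _)
⊙-cong (no ¬p) e to from refl = sym (⊙-no e (¬p ∘ from) _)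

∣-⊙ : ∀ {p} (d : Dec Φ) {n} → (Φ → p ∣ n) → p ∣ d ⊙ n
∣-⊙ (yes x) h = h x
∣-⊙ (no _)  h = _ ∣0

∑ : List I → (I → ℕ) → ℕ
∑ xs g = sum (map g xs)

∑-cong : (xs : List I) {g h : I → ℕ} → (∀ x → g x ≡ h x) → ∑ xs g ≡ ∑ xs h
∑-cong []       e = refl
∑-cong (x ∷ xs) e = cong₂ _+_ (e x) (∑-cong xs e)

∑-+ : (xs : List I) (g h : I → ℕ) → ∑ xs (λ x → g x + h x) ≡ ∑ xs g + ∑ xs h
∑-+ []       g h = refl
∑-+ (x ∷ xs) g h = trans (cong (g x + h x +_) (∑-+ xs g h)) (interchange (g x) (h x) _ _)

∑-const : (xs : List I) (n : ℕ) → ∑ xs (λ _ → n) ≡ length xs * n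
∑-const []       n = refl
∑-const (x ∷ xs) n = cong (n +_) (∑-const xs n)

∑-zero : (xs : List I) {g : I → ℕ} → (∀ x → g x ≡ 0) → ∑ xs g ≡ 0
∑-zero xs e = trans (∑-cong xs e) (trans (∑-const xs 0) (ℕₚ.*-zeroʳ (length xs)))

∑-swap : (xs : List I) (ys : List J) (g : I → J → ℕ) →
         ∑ xs (λ x → ∑ ys (g x)) ≡ ∑ ys (λ y → ∑ xs (λ x → g x y))
∑-swap []       ys g = sym (∑-zero ys (λ _ → refl))
∑-swap (x ∷ xs) ys g = trans (cong (∑ ys (g x) +_) (∑-swap xs ys g)) (sym (∑-+ ys (g x) _))

∑-⊙ : (d : Dec Φ) (xs : List I) (g : I → ℕ) → ∑ xs (λ x → d ⊙ g x) ≡ d ⊙ ∑ xs g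
∑-⊙ (yes _) xs g = refl
∑-⊙ (no _)  xs g = ∑-zero xs (λ _ → refl)

∑-mono : (xs : List I) {g h : I → ℕ} → (∀ x → g x ≤ h x) → ∑ xs g ≤ ∑ xs h
∑-mono []       le = z≤n
∑-mono (x ∷ xs) le = ℕₚ.+-mono-≤ (le x) (∑-mono xs le)

∑-mono-< : {xs : List I} {g h : I → ℕ} → (∀ x → g x ≤ h x) → ∀ {a} → a ∈ xs → g a < h a → ∑ xs g < ∑ xs h
∑-mono-< {xs = _ ∷ xs} le (here refl) lt = ℕₚ.+-mono-<-≤ lt (∑-mono xs le)
∑-mono-< le (there a∈)  lt = ℕₚ.+-mono-≤-< (le _) (∑-mono-< le a∈ lt)

∣-∑ : ∀ {p} (xs : List I) {g : I → ℕ} → (∀ x → p ∣ g x) → p ∣ ∑ xs g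
∣-∑ []       h = _ ∣0
∣-∑ (x ∷ xs) h = ∣m∣n⇒∣m+n (h x) (∣-∑ xs h)

term≤∑ : {xs : List I} (g : I → ℕ) → ∀ {a} → a ∈ xs → g a ≤ ∑ xs g
term≤∑ g (here refl) = ℕₚ.m≤m+n _ _
term≤∑ g (there a∈)  = ℕₚ.≤-trans (term≤∑ g a∈) (ℕₚ.m≤n+m _ _)

∑-unique : {xs : List I} → Unique xs → ∀ {a} → a ∈ xs → {g : I → ℕ} → (∀ x → x ≢ a → g x ≡ 0) → ∑ xs g ≡ g a
∑-unique {xs = x ∷ xs} (x∉ ∷ u) (here refl) {g} z = trans (cong (g x +_) (rest xs x∉)) (ℕₚ.+-identityʳ _)
  where
  rest : ∀ ys → All.All (x ≢_) ys → ∑ ys g ≡ 0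
  rest []       _                = refl
  rest (y ∷ ys) (x≢y All.∷ more) = cong₂ _+_ (z y (x≢y ∘ sym)) (rest ys more)
∑-unique (x∉ ∷ u) (there a∈) z = cong₂ _+_ (z _ (All.lookup x∉ a∈)) (∑-unique u a∈ z)

-- Finite types as ranges of summation.

record Enumeration (I : Set) : Set₁ where
  field
    list   : List I
    covers : ∀ a → a ∈ list
    -- Freedom from repetition, stated as a property of sums: in this form it passes to vectors
    -- through iterated sums.
    single : ∀ a {g : I → ℕ} → (∀ x → x ≢ a → g x ≡ 0) → ∑ list g ≡ g a
    _≟_    : DecidableEquality I
    search : {Φ : I → Set} → (∀ x → Dec (Φ x)) → Dec (∃ Φ)

  single-≟ : ∀ a (g : I → ℕ) → ∑ list (λ x → (x ≟ a) ⊙ g x) ≡ g a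
  single-≟ a g = trans (single a (λ x x≢a → ⊙-no (x ≟ a) x≢a (g x))) (⊙-yes (a ≟ a) refl (g a))

  single-Dec : {Φ : I → Set} (P? : ∀ x → Dec (Φ x)) {a : I} → Φ a → (∀ x → Φ x → x ≡ a) →
               ∀ (g : I → ℕ) → ∑ list (λ x → P? x ⊙ g x) ≡ g a
  single-Dec P? {a} pa uniq g =
    trans (single a (λ x x≢a → ⊙-no (P? x) (x≢a ∘ uniq x) (g x))) (⊙-yes (P? a) pa (g a))

  all? : {Φ : I → Set} → (∀ x → Dec (Φ x)) → (∃ λ x → ¬ Φ x) ⊎ (∀ x → Φ x)
  all? P? with search (λ x → ¬? (P? x))
  ... | yes found = inj₁ found
  ... | no none   = inj₂ λ x → decidable-stable (P? x) (λ ¬px → none (x , ¬px))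

open Enumeration using (list; _≟_; single-≟; single-Dec)

∑-fibre : (E : Enumeration J) (xs : List I) (σ : I → J) (w : I → ℕ) →
          ∑ xs w ≡ ∑ (list E) (λ b → ∑ xs (λ a → _≟_ E b (σ a) ⊙ w a))
∑-fibre E xs σ w =
  trans (∑-cong xs (λ a → sym (single-≟ E (σ a) (λ _ → w a))))
        (∑-swap xs (list E) _)

∑-reindex : (D : Enumeration I) (E : Enumeration J) (σ : I → J) (τ : J → I) →
            (∀ a → τ (σ a) ≡ a) → (∀ b → σ (τ b) ≡ b) → (g : J → ℕ) →
            ∑ (list D) (g ∘ σ) ≡ ∑ (list E) g
∑-reindex D E σ τ τσ στ g =
  trans (∑-fibre E (list D) σ (g ∘ σ))
        (∑-cong (list E) λ b →
          trans (single-Dec D (λ a → _≟_ E b (σ a)) (sym (στ b))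
                   (λ a b≡σa → trans (sym (τσ a)) (cong τ (sym b≡σa))) (g ∘ σ))
                (cong g (στ b)))

∑-++ : (xs ys : List I) (g : I → ℕ) → ∑ (xs ++ ys) g ≡ ∑ xs g + ∑ ys g
∑-++ xs ys g = trans (cong sum (map-++ g xs ys)) (sum-++ (map g xs) (map g ys))

∑-map : (h : I → J) (xs : List I) (g : J → ℕ) → ∑ (map h xs) g ≡ ∑ xs (g ∘ h)
∑-map h xs g = cong sum (sym (map-∘ xs))

∑-concatMap : (h : I → List J) (xs : List I) (g : J → ℕ) →
              ∑ (concatMap h xs) g ≡ ∑ xs (λ x → ∑ (h x) g)
∑-concatMap h []       g = refl
∑-concatMap h (x ∷ xs) g = trans (∑-++ (h x) (concatMap h xs) g) (cong (∑ (h x) g +_) (∑-concatMap h xs g))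

-- Linear algebra over the finite field.

module Vectors (F : FiniteField) where
  open FiniteField F public

  fieldRing : CommutativeRing _ _
  fieldRing = record { isCommutativeRing = isCommutativeRing }

  open CommutativeRing fieldRing public using
    (+-assoc; +-identityˡ; +-identityʳ; -‿inverseˡ; -‿inverseʳ; *-assoc; *-identityˡ; *-identityʳ;
     distribˡ; distribʳ; zeroˡ; zeroʳ)
    renaming (+-comm to +F-comm; *-comm to *F-comm)
  open Algebra.Properties.Ring (CommutativeRing.ring fieldRing) public using
    (-‿distribˡ-*; -‿distribʳ-*; -0#≈0#; -‿involutive; -‿+-comm; +-cancelˡ)
    renaming (+-inverseʳ-unique to inverseʳ-unique)
  open Algebra.Properties.CommutativeSemigroup (CommutativeRing.+-commutativeSemigroup fieldRing) public
    using () renaming (interchange to +F-interchange)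

  inv : ∀ x → x ≢ 0F → Carrier
  inv x x≢0 = proj₁ (inverse x x≢0)

  *-inverseʳ : ∀ x (x≢0 : x ≢ 0F) → x *F inv x x≢0 ≡ 1F
  *-inverseʳ x x≢0 = proj₂ (inverse x x≢0)

  *-inverseˡ : ∀ x (x≢0 : x ≢ 0F) → inv x x≢0 *F x ≡ 1F
  *-inverseˡ x x≢0 = trans (*F-comm _ _) (*-inverseʳ x x≢0)

  inv≢0 : ∀ x (x≢0 : x ≢ 0F) → inv x x≢0 ≢ 0F
  inv≢0 x x≢0 eq = 0≢1 (trans (sym (zeroʳ x)) (trans (cong (x *F_) (sym eq)) (*-inverseʳ x x≢0)))

  *-cancel-inv : ∀ x (x≢0 : x ≢ 0F) y → (y *F x) *F inv x x≢0 ≡ y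
  *-cancel-inv x x≢0 y = trans (*-assoc y x _) (trans (cong (y *F_) (*-inverseʳ x x≢0)) (*-identityʳ y))

  *-cancel-invˡ : ∀ x (x≢0 : x ≢ 0F) y → (y *F inv x x≢0) *F x ≡ y
  *-cancel-invˡ x x≢0 y = trans (*-assoc y _ x) (trans (cong (y *F_) (*-inverseˡ x x≢0)) (*-identityʳ y))

  1≢0 : 1F ≢ 0F
  1≢0 = 0≢1 ∘ sym

  -1≢0 : -F 1F ≢ 0F
  -1≢0 eq = 0≢1 (trans (sym -0#≈0#) (trans (cong -F_ (sym eq)) (-‿involutive 1F)))

  𝔽 : Enumeration Carrier
  𝔽 = record
    { list   = elements
    ; covers = complete
    ; single = λ a → ∑-unique unique (complete a)
    ; _≟_    = _≟F_
    ; search = λ P? → map′ (λ p → let x , _ , px = find p in x , px) (λ (x , px) → lose (complete x) px)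
                        (any? P? elements)
    }

  V : ℕ → Set
  V = Vec Carrier

  vectors : ∀ m → List (V m)
  vectors zero    = [] ∷ []
  vectors (suc m) = concatMap (λ x → map (x ∷_) (vectors m)) elements

  ∑-vectors-suc : ∀ m (g : V (suc m) → ℕ) →
                  ∑ (vectors (suc m)) g ≡ ∑ elements (λ x → ∑ (vectors m) (λ v → g (x ∷ v)))
  ∑-vectors-suc m g = trans (∑-concatMap _ elements g)
                            (∑-cong elements λ x → ∑-map (x ∷_) (vectors m) g)

  searchV : ∀ m {P : V m → Set} → (∀ v → Dec (P v)) → Dec (∃ P)
  searchV zero    P? = map′ (λ p → [] , p) (λ { ([] , p) → p }) (P? [])
  searchV (suc m) P? = map′ (λ (x , v , p) → x ∷ v , p) (λ { (x ∷ v , p) → x , v , p })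
                         (Enumeration.search 𝔽 λ x → searchV m λ v → P? (x ∷ v))

  _≟V_ : ∀ {m} → DecidableEquality (V m)
  _≟V_ = Vecₚ.≡-dec _≟F_

  𝕍 : ∀ m → Enumeration (V m)
  𝕍 m = record
    { list = vectors m ; covers = covers m ; single = single m
    ; _≟_ = _≟V_ ; search = searchV m }
    where
    covers : ∀ m (v : V m) → v ∈ vectors m
    covers zero    []      = here refl
    covers (suc m) (x ∷ v) = ∈-concatMap⁺ _ (lose (complete x) (∈-map⁺ (x ∷_) (covers m v)))

    single : ∀ m (a : V m) {g : V m → ℕ} → (∀ x → x ≢ a → g x ≡ 0) → ∑ (vectors m) g ≡ g a
    single zero    []      z = ℕₚ.+-identityʳ _
    single (suc m) (a ∷ v) {g} z = trans (∑-vectors-suc m g) (trans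
      (Enumeration.single 𝔽 a λ x x≢a → ∑-zero (vectors m) λ w → z (x ∷ w) λ eq → x≢a (Vecₚ.∷-injectiveˡ eq))
      (single m v λ w w≢v → z (a ∷ w) λ eq → w≢v (Vecₚ.∷-injectiveʳ eq)))

  infixl 6 _⊕_
  infixr 7 _·_

  _⊕_ : ∀ {m} → V m → V m → V m
  _⊕_ = zipWith _+F_

  _·_ : ∀ {m} → Carrier → V m → V m
  a · v = mapV (a *F_) v

  𝟎 : ∀ {m} → V m
  𝟎 = replicate _ 0F

  private variable m : ℕ

  ⊕-assoc : (u v w : V m) → (u ⊕ v) ⊕ w ≡ u ⊕ (v ⊕ w)
  ⊕-assoc = Vecₚ.zipWith-assoc +-assoc

  ⊕-comm : (u v : V m) → u ⊕ v ≡ v ⊕ u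
  ⊕-comm = Vecₚ.zipWith-comm +F-comm

  ⊕-identityˡ : (v : V m) → 𝟎 ⊕ v ≡ v
  ⊕-identityˡ = Vecₚ.zipWith-identityˡ +-identityˡ

  ⊕-identityʳ : (v : V m) → v ⊕ 𝟎 ≡ v
  ⊕-identityʳ = Vecₚ.zipWith-identityʳ +-identityʳ

  ⊕-interchange : (t u v w : V m) → (t ⊕ u) ⊕ (v ⊕ w) ≡ (t ⊕ v) ⊕ (u ⊕ w)
  ⊕-interchange []      []      []      []      = refl
  ⊕-interchange (a ∷ t) (b ∷ u) (c ∷ v) (d ∷ w) = cong₂ _∷_ (+F-interchange a b c d) (⊕-interchange t u v w)

  ·-distribˡ : ∀ a (u v : V m) → a · (u ⊕ v) ≡ a · u ⊕ a · v
  ·-distribˡ a []      []      = refl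
  ·-distribˡ a (b ∷ u) (c ∷ v) = cong₂ _∷_ (distribˡ a b c) (·-distribˡ a u v)

  ·-distribʳ : ∀ a b (v : V m) → (a +F b) · v ≡ a · v ⊕ b · v
  ·-distribʳ a b []      = refl
  ·-distribʳ a b (c ∷ v) = cong₂ _∷_ (distribʳ c a b) (·-distribʳ a b v)

  ·-assoc : ∀ a b (v : V m) → (a *F b) · v ≡ a · b · v
  ·-assoc a b []      = refl
  ·-assoc a b (c ∷ v) = cong₂ _∷_ (*-assoc a b c) (·-assoc a b v)

  ·-identity : (v : V m) → 1F · v ≡ v
  ·-identity []      = refl
  ·-identity (c ∷ v) = cong₂ _∷_ (*-identityˡ c) (·-identity v)

  ·-zeroˡ : (v : V m) → 0F · v ≡ 𝟎
  ·-zeroˡ []      = refl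
  ·-zeroˡ (c ∷ v) = cong₂ _∷_ (zeroˡ c) (·-zeroˡ v)

  ·-zeroʳ : ∀ a → a · 𝟎 {m} ≡ 𝟎
  ·-zeroʳ {zero}  a = refl
  ·-zeroʳ {suc m} a = cong₂ _∷_ (zeroʳ a) (·-zeroʳ a)

  ⊖_ : V m → V m
  ⊖ v = -F 1F · v

  ⊖-inverseʳ : (v : V m) → v ⊕ ⊖ v ≡ 𝟎
  ⊖-inverseʳ v = trans (cong (_⊕ ⊖ v) (sym (·-identity v)))
    (trans (sym (·-distribʳ 1F (-F 1F) v)) (trans (cong (_· v) (-‿inverseʳ 1F)) (·-zeroˡ v)))

  inv·· : ∀ a (a≢0 : a ≢ 0F) (v : V m) → inv a a≢0 · a · v ≡ v
  inv·· a a≢0 v = trans (sym (·-assoc _ a v)) (trans (cong (_· v) (*-inverseˡ a a≢0)) (·-identity v))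

  ·inv· : ∀ a (a≢0 : a ≢ 0F) (v : V m) → a · inv a a≢0 · v ≡ v
  ·inv· a a≢0 v = trans (sym (·-assoc a _ v)) (trans (cong (_· v) (*-inverseʳ a a≢0)) (·-identity v))

  record LinearForm (φ : V m → Carrier) : Set where
    field
      form-⊕ : ∀ x y → φ (x ⊕ y) ≡ φ x +F φ y
      form-· : ∀ a x → φ (a · x) ≡ a *F φ x

    form-𝟎 : φ 𝟎 ≡ 0F
    form-𝟎 = trans (cong φ (sym (·-zeroˡ 𝟎))) (trans (form-· 0F 𝟎) (zeroˡ _))

  record Linear {m e} (T : V m → V e) : Set where
    field
      map-⊕ : ∀ x y → T (x ⊕ y) ≡ T x ⊕ T y
      map-· : ∀ a x → T (a · x) ≡ a · T x

    map-𝟎 : T 𝟎 ≡ 𝟎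
    map-𝟎 = trans (cong T (sym (·-zeroˡ 𝟎))) (trans (map-· 0F 𝟎) (·-zeroˡ _))

  record Subspace (U : V m → Set) : Set where
    field
      closed-⊕ : ∀ {x y} → U x → U y → U (x ⊕ y)
      closed-· : ∀ a {x} → U x → U (a · x)

  open LinearForm public
  open Linear public
  open Subspace public

  Ker : ∀ {e} → (V m → V e) → V m → Set
  Ker κ x = κ x ≡ 𝟎

  Ker₁ : (V m → Carrier) → V m → Set
  Ker₁ φ x = φ x ≡ 0F

  whole : Subspace {m} (λ _ → ⊤)
  whole = record { closed-⊕ = λ _ _ → tt ; closed-· = λ _ _ → tt }

  ker : ∀ {e} {κ : V m → V e} → Linear κ → Subspace (Ker κ)
  ker lin = record
    { closed-⊕ = λ {x} {y} p q → trans (map-⊕ lin x y) (trans (cong₂ _⊕_ p q) (⊕-identityˡ 𝟎))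
    ; closed-· = λ a {x} p → trans (map-· lin a x) (trans (cong (a ·_) p) (·-zeroʳ a)) }

  ker₁ : {φ : V m → Carrier} → LinearForm φ → Subspace (Ker₁ φ)
  ker₁ lin = record
    { closed-⊕ = λ {x} {y} p q → trans (form-⊕ lin x y) (trans (cong₂ _+F_ p q) (+-identityˡ 0F))
    ; closed-· = λ a {x} p → trans (form-· lin a x) (trans (cong (a *F_) p) (zeroʳ a)) }

  _∩_ : (V m → Set) → (V m → Set) → V m → Set
  (U ∩ U′) x = U x × U′ x

  ∩-subspace : {U U′ : V m → Set} → Subspace U → Subspace U′ → Subspace (U ∩ U′)
  ∩-subspace S S′ = record
    { closed-⊕ = λ (p , p′) (q , q′) → closed-⊕ S p q , closed-⊕ S′ p′ q′
    ; closed-· = λ a (p , p′) → closed-· S a p , closed-· S′ a p′ }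

  -- The sum over the coset x + ⟨vs⟩, with multiplicity if `vs` is dependent. The base point `x` is
  -- needed because each vector of the tuple shifts it in the recursion.
  spanSum : ∀ {j} → Vec (V m) j → (V m → ℕ) → V m → ℕ
  spanSum []       g x = g x
  spanSum (v ∷ vs) g x = ∑ elements (λ y → spanSum vs g (x ⊕ y · v))

  spanSum-cong : ∀ {j} (vs : Vec (V m) j) {g h : V m → ℕ} → (∀ x → g x ≡ h x) → ∀ x → spanSum vs g x ≡ spanSum vs h x
  spanSum-cong []       e x = e x
  spanSum-cong (v ∷ vs) e x = ∑-cong elements λ y → spanSum-cong vs e (x ⊕ y · v)

  spanSum-+ : ∀ {j} (vs : Vec (V m) j) (g h : V m → ℕ) x →
              spanSum vs (λ z → g z + h z) x ≡ spanSum vs g x + spanSum vs h x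
  spanSum-+ []       g h x = refl
  spanSum-+ (v ∷ vs) g h x =
    trans (∑-cong elements λ y → spanSum-+ vs g h (x ⊕ y · v)) (∑-+ elements _ _)

  spanSum-∑ : ∀ {j} (vs : Vec (V m) j) (g : Carrier → V m → ℕ) x →
              spanSum vs (λ z → ∑ elements λ y → g y z) x ≡ ∑ elements (λ y → spanSum vs (g y) x)
  spanSum-∑ []       g x = refl
  spanSum-∑ (v ∷ vs) g x =
    trans (∑-cong elements λ y → spanSum-∑ vs g (x ⊕ y · v)) (∑-swap elements elements _)

  spanSum-translate : ∀ {j} (vs : Vec (V m) j) (g : V m → ℕ) t x →
                      spanSum vs (λ z → g (z ⊕ t)) x ≡ spanSum vs g (x ⊕ t)
  spanSum-translate []       g t x = refl
  spanSum-translate (v ∷ vs) g t x = ∑-cong elements λ y →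
    trans (spanSum-translate vs g t (x ⊕ y · v))
          (cong (spanSum vs g) (trans (⊕-assoc x _ t) (trans (cong (x ⊕_) (⊕-comm _ t)) (sym (⊕-assoc x t _)))))

  cut : (V m → Carrier) → (V m → ℕ) → V m → ℕ
  cut φ g x = (φ x ≟F 0F) ⊙ g x

  -- `φ` is constant on x + ⟨vs⟩, so the cut keeps the whole coset or nothing.
  spanSum-cut-Ker : {φ : V m → Carrier} → LinearForm φ → ∀ {j} {vs : Vec (V m) j} → VecAll (Ker₁ φ) vs → ∀ g x →
                spanSum vs (cut φ g) x ≡ (φ x ≟F 0F) ⊙ spanSum vs g x
  spanSum-cut-Ker lin []                 g x = refl
  spanSum-cut-Ker {φ = φ} lin (_∷_ {x = v} {xs = vs} φv≡0 vs∈) g x =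
    trans (∑-cong elements λ y → trans (spanSum-cut-Ker lin vs∈ g (x ⊕ y · v))
             (cong (λ t → (t ≟F 0F) ⊙ spanSum vs g (x ⊕ y · v)) (φ-shift y)))
          (∑-⊙ (φ x ≟F 0F) elements _)
    where
    φ-shift : ∀ y → φ (x ⊕ y · v) ≡ φ x
    φ-shift y = trans (form-⊕ lin x (y · v))
      (trans (cong (φ x +F_) (trans (form-· lin y v) (trans (cong (y *F_) φv≡0) (zeroʳ y)))) (+-identityʳ _))

  -- The intersection of x + ⟨vs⟩ with the hyperplane φ = 0, multiplicities included: it is a coset
  -- of ⟨tuple⟩, and subtracting φ(x) times the apex moves `x` into it.
  record Section (U : V m → Set) (φ : V m → Carrier) {j} (vs : Vec (V m) (suc j)) : Set where
    field
      apex    : V m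
      apex∈   : U apex
      φ-apex  : φ apex ≡ 1F
      tuple   : Vec (V m) j
      tuple∈  : VecAll (U ∩ Ker₁ φ) tuple
      sum-cut : ∀ g x → spanSum vs (cut φ g) x ≡ spanSum tuple g (x ⊕ (-F φ x) · apex)

  open Section

  -- Gaussian elimination with one form. The rightmost vector outside the kernel, scaled to
  -- `φ`-value 1, becomes the apex; the vectors before it are corrected by multiples of the apex,
  -- and those after it are kept.
  section : {U : V m → Set} {φ : V m → Carrier} → Subspace U → LinearForm φ →
            ∀ {j} (vs : Vec (V m) (suc j)) → VecAll U vs → VecAll (Ker₁ φ) vs ⊎ Section U φ vs
  section-∷ : {U : V m → Set} {φ : V m → Carrier} → Subspace U → LinearForm φ →
              ∀ {j} v (vs : Vec (V m) j) → U v → VecAll U vs → VecAll (Ker₁ φ) vs → VecAll (Ker₁ φ) (v ∷ vs) ⊎ Section U φ (v ∷ vs)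
  section {φ = φ} S lin (v ∷ []) (v∈ ∷ []) = section-∷ S lin v [] v∈ [] []
  section {φ = φ} S lin (v ∷ vs@(_ ∷ _)) (v∈ ∷ vs∈) with section S lin vs vs∈
  ... | inj₁ vs∈ker = section-∷ S lin v vs v∈ vs∈ vs∈ker
  ... | inj₂ s = inj₂ record
    { apex = u ; apex∈ = apex∈ s ; φ-apex = φ-apex s
    ; tuple = w ∷ tuple s
    ; tuple∈ = (closed-⊕ S v∈ (closed-· S _ (apex∈ s)) , φw) ∷ tuple∈ s
    ; sum-cut = λ g x → ∑-cong elements λ y →
        trans (sum-cut s g (x ⊕ y · v)) (cong (spanSum (tuple s) g) (shift x y)) }
    where
    u = apex s
    w = v ⊕ (-F φ v) · u
    φw : φ w ≡ 0F
    φw = trans (form-⊕ lin v _) (trans (cong (φ v +F_) (trans (form-· lin _ u)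
           (trans (cong ((-F φ v) *F_) (φ-apex s)) (*-identityʳ _)))) (-‿inverseʳ (φ v)))
    shift : ∀ x y → (x ⊕ y · v) ⊕ (-F φ (x ⊕ y · v)) · u ≡ (x ⊕ (-F φ x) · u) ⊕ y · w
    shift x y = trans (cong ((x ⊕ y · v) ⊕_) (trans (cong (_· u) neg) (·-distribʳ _ _ u)))
      (trans (⊕-interchange x _ _ _) (cong ((x ⊕ (-F φ x) · u) ⊕_)
        (trans (cong (y · v ⊕_) (·-assoc y _ u)) (sym (·-distribˡ y v _)))))
      where
      neg : -F φ (x ⊕ y · v) ≡ (-F φ x) +F (y *F (-F φ v))
      neg = trans (cong -F_ (trans (form-⊕ lin x _) (cong (φ x +F_) (form-· lin y v))))
        (trans (sym (-‿+-comm _ _)) (cong ((-F φ x) +F_) (-‿distribʳ-* y (φ v))))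
  section-∷ {φ = φ} S lin v vs v∈ vs∈ vs∈ker with φ v ≟F 0F
  ... | yes φv≡0 = inj₁ (φv≡0 ∷ vs∈ker)
  ... | no φv≢0 = inj₂ record
    { apex = i · v ; apex∈ = closed-· S i v∈
    ; φ-apex = trans (form-· lin i v) (*-inverseˡ _ φv≢0)
    ; tuple = vs ; tuple∈ = VAll.zip (vs∈ , vs∈ker)
    ; sum-cut = λ g x →
        trans (∑-cong elements λ y → spanSum-cut-Ker lin vs∈ker g (x ⊕ y · v))
        -- As `φ v` is nonzero, exactly one `y` brings x + y·v into the kernel, so the sum over `y`
        -- has a single term.
        (trans (Enumeration.single-Dec 𝔽 (λ y → φ (x ⊕ y · v) ≟F 0F) {(-F φ x) *F i} (root x) (root-unique x) _)
               (cong (λ z → spanSum vs g (x ⊕ z)) (·-assoc _ i v))) }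
    where
    i = inv (φ v) φv≢0
    φ-line : ∀ x y → φ (x ⊕ y · v) ≡ φ x +F (y *F φ v)
    φ-line x y = trans (form-⊕ lin x _) (cong (φ x +F_) (form-· lin y v))
    root : ∀ x → φ (x ⊕ ((-F φ x) *F i) · v) ≡ 0F
    root x = trans (φ-line x _) (trans (cong (φ x +F_) (*-cancel-invˡ (φ v) φv≢0 _)) (-‿inverseʳ _))
    root-unique : ∀ x y → φ (x ⊕ y · v) ≡ 0F → y ≡ (-F φ x) *F i
    root-unique x y eq = trans (sym (*-cancel-inv (φ v) φv≢0 y))
      (cong (_*F i) (inverseʳ-unique (φ x) _ (trans (sym (φ-line x y)) eq)))

  cutᵥ : ∀ {e} → (V m → V e) → (V m → ℕ) → V m → ℕ
  cutᵥ κ g x = (κ x ≟V 𝟎) ⊙ g x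

  head-form : ∀ {e} {κ : V m → V (suc e)} → Linear κ → LinearForm (head ∘ κ)
  head-form {κ = κ} lin = record
    { form-⊕ = λ x y → trans (cong head (map-⊕ lin x y)) (head-⊕ (κ x) (κ y))
    ; form-· = λ a x → trans (cong head (map-· lin a x)) (head-· a (κ x)) }
    where
    head-⊕ : ∀ {e} (u v : V (suc e)) → head (u ⊕ v) ≡ head u +F head v
    head-⊕ (_ ∷ _) (_ ∷ _) = refl
    head-· : ∀ {e} a (u : V (suc e)) → head (a · u) ≡ a *F head u
    head-· a (_ ∷ _) = refl

  tail-linear : ∀ {e} {κ : V m → V (suc e)} → Linear κ → Linear (tail ∘ κ)
  tail-linear {κ = κ} lin = record
    { map-⊕ = λ x y → trans (cong tail (map-⊕ lin x y)) (tail-⊕ (κ x) (κ y))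
    ; map-· = λ a x → trans (cong tail (map-· lin a x)) (tail-· a (κ x)) }
    where
    tail-⊕ : ∀ {e} (u v : V (suc e)) → tail (u ⊕ v) ≡ tail u ⊕ tail v
    tail-⊕ (_ ∷ _) (_ ∷ _) = refl
    tail-· : ∀ {e} a (u : V (suc e)) → tail (a · u) ≡ a · tail u
    tail-· a (_ ∷ _) = refl

  -- Functions whose sums over subspaces of a given dimension vanish mod p.

  module Sums {p : ℕ} (p∣q : p ∣ order) where

    p∣∑-const : ∀ n → p ∣ ∑ elements (λ _ → n)
    p∣∑-const n = subst (p ∣_) (sym (∑-const elements n)) (∣m⇒∣m*n n p∣q)

    Balanced : (V m → Set) → ℕ → (V m → ℕ) → Set
    Balanced {m} U j g = (vs : Vec (V m) j) → VecAll U vs → p ∣ spanSum vs g 𝟎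

    spanSum-∣ : ∀ {j} (vs : Vec (V m) j) {g : V m → ℕ} → (∀ x → p ∣ g x) → ∀ x → p ∣ spanSum vs g x
    spanSum-∣ []       h x = h x
    spanSum-∣ (v ∷ vs) h x = ∣-∑ elements λ y → spanSum-∣ vs h (x ⊕ y · v)

    -- The hyperplanes of ⟨v, w, vs⟩ through ⟨vs⟩ are ⟨w, vs⟩ and the ⟨v + bw, vs⟩, b ∈ F; all their
    -- sums vanish, and ⟨vs⟩ is counted q + 1 times among them.
    balanced-suc : {U : V m → Set} → Subspace U → ∀ {j g} → Balanced U (suc j) g → Balanced U (suc (suc j)) g
    balanced-suc S {g = g} bal (v ∷ w ∷ vs) (v∈ ∷ w∈ ∷ vs∈) =
      ∣m+n∣m⇒∣n (subst (p ∣_) (sym total) (∣m∣n⇒∣m+n p∣A p∣line₀)) (p∣∑-const (cell 0F 0F))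
      where
      cell : Carrier → Carrier → ℕ
      cell y z = spanSum vs g ((𝟎 ⊕ y · v) ⊕ z · w)
      A : Carrier → ℕ
      A y = ∑ elements λ b → cell y (y *F b)
      c = ∑ elements λ _ → cell 0F 0F
      line₀ = ∑ elements (cell 0F)

      p∣A : p ∣ ∑ elements A
      p∣A = subst (p ∣_) (∑-swap elements elements _) (∣-∑ elements λ b →
        subst (p ∣_) (∑-cong elements λ y → cong (spanSum vs g)
            (trans (cong (𝟎 ⊕_) (trans (·-distribˡ y v _) (cong (y · v ⊕_) (sym (·-assoc y b w)))))
                   (sym (⊕-assoc 𝟎 _ _))))
          (bal ((v ⊕ b · w) ∷ vs) (closed-⊕ S v∈ (closed-· S b w∈) ∷ vs∈)))

      p∣line₀ : p ∣ line₀
      p∣line₀ = subst (p ∣_) (∑-cong elements λ z → cong (λ t → spanSum vs g (t ⊕ z · w))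
          (sym (trans (cong (𝟎 ⊕_) (·-zeroˡ v)) (⊕-identityˡ 𝟎))))
        (bal (w ∷ vs) (w∈ ∷ vs∈))

      pointwise : ∀ y → (y ≟F 0F) ⊙ c + ∑ elements (cell y) ≡ A y + (y ≟F 0F) ⊙ line₀
      pointwise y with y ≟F 0F
      ... | yes refl = cong (_+ line₀) (∑-cong elements λ b → cong (cell 0F) (sym (zeroˡ b)))
      ... | no y≢0 = sym (trans (ℕₚ.+-identityʳ _)
        (∑-reindex 𝔽 𝔽 (y *F_) (inv y y≢0 *F_)
          (λ b → trans (sym (*-assoc _ y b)) (trans (cong (_*F b) (*-inverseˡ y y≢0)) (*-identityˡ b)))
          (λ b → trans (sym (*-assoc y _ b)) (trans (cong (_*F b) (*-inverseʳ y y≢0)) (*-identityˡ b)))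
          (cell y)))

      total : c + ∑ elements (λ y → ∑ elements (cell y)) ≡ ∑ elements A + line₀
      total = begin
        c + ∑ elements (λ y → ∑ elements (cell y))
          ≡⟨ cong (_+ ∑ elements (λ y → ∑ elements (cell y))) (Enumeration.single-≟ 𝔽 0F (λ _ → c)) ⟨
        ∑ elements (λ y → (y ≟F 0F) ⊙ c) + ∑ elements (λ y → ∑ elements (cell y))
          ≡⟨ ∑-+ elements _ _ ⟨
        ∑ elements (λ y → (y ≟F 0F) ⊙ c + ∑ elements (cell y))
          ≡⟨ ∑-cong elements pointwise ⟩
        ∑ elements (λ y → A y + (y ≟F 0F) ⊙ line₀)
          ≡⟨ ∑-+ elements _ _ ⟩
        ∑ elements A + ∑ elements (λ y → (y ≟F 0F) ⊙ line₀)
          ≡⟨ cong (∑ elements A +_) (Enumeration.single-≟ 𝔽 0F (λ _ → line₀)) ⟩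
        ∑ elements A + line₀ ∎
        where open ≡-Reasoning

    balanced-≤ : {U : V m → Set} → Subspace U → ∀ {i j g} → i ≤′ j → Balanced U (suc i) g → Balanced U (suc j) g
    balanced-≤ S ≤′-refl       bal = bal
    balanced-≤ S (≤′-step i≤j) bal = balanced-suc S (balanced-≤ S i≤j bal)

    -- A (j+2)-dimensional subspace meets a hyperplane in dimension j+1, where the hypothesis
    -- applies, or lies inside it, where `balanced-suc` supplies the extra dimension.
    balanced-cut : {U : V m → Set} {φ : V m → Carrier} → Subspace U → LinearForm φ → ∀ {j g} →
                   Balanced (U ∩ Ker₁ φ) (suc j) g → Balanced U (suc (suc j)) (cut φ g)
    balanced-cut {φ = φ} S lin {g = g} bal vs vs∈ with section S lin vs vs∈
    ... | inj₁ vs∈ker = subst (p ∣_)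
            (sym (trans (spanSum-cut-Ker lin vs∈ker g 𝟎) (⊙-yes (φ 𝟎 ≟F 0F) (form-𝟎 lin) _)))
            (balanced-suc (∩-subspace S (ker₁ lin)) bal vs (VAll.zip (vs∈ , vs∈ker)))
    ... | inj₂ s = subst (p ∣_)
            (sym (trans (sum-cut s g 𝟎) (cong (spanSum (tuple s) g) offset)))
            (bal (tuple s) (tuple∈ s))
      where
      offset : 𝟎 ⊕ (-F φ 𝟎) · apex s ≡ 𝟎
      offset = trans (⊕-identityˡ _) (trans (cong (_· apex s)
        (trans (cong -F_ (form-𝟎 lin)) -0#≈0#)) (·-zeroˡ _))

    balanced-cong : {U U′ : V m → Set} → ∀ {j} {g h : V m → ℕ} → (∀ {x} → U′ x → U x) → (∀ x → g x ≡ h x) →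
                    Balanced U j g → Balanced U′ j h
    balanced-cong U′⊆U g≗h bal vs vs∈ = subst (p ∣_) (spanSum-cong vs g≗h 𝟎) (bal vs (VAll.map U′⊆U vs∈))

    -- Imposing e linear equations costs at most e dimensions. The equations are imposed one at a
    -- time, and `U` shrinks along the induction so that the hypothesis is required only on the
    -- common kernel.
    balanced-cutᵥ : ∀ {e} {U : V m → Set} {κ : V m → V e} → Subspace U → Linear κ → ∀ {j g} →
                    Balanced (U ∩ Ker κ) (suc j) g → Balanced U (suc (e + j)) (cutᵥ κ g)
    balanced-cutᵥ {e = zero} {κ = κ} S lin {g = g} bal = balanced-cong (λ {x} x∈ → x∈ , trivial (κ x))
      (λ x → sym (⊙-yes (κ x ≟V 𝟎) (trivial (κ x)) (g x))) bal
      where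
      trivial : (v : V 0) → v ≡ 𝟎
      trivial [] = refl
    balanced-cutᵥ {e = suc e} {κ = κ} S lin {g = g} bal =
      balanced-cong id cuts
        (balanced-cut S (head-form lin)
          (balanced-cutᵥ (∩-subspace S (ker₁ (head-form lin))) (tail-linear lin)
            (balanced-cong (λ {x} ((x∈ , h) , t) → x∈ , join (κ x) h t) (λ _ → refl) bal)))
      where
      join : (v : V (suc e)) → head v ≡ 0F → tail v ≡ 𝟎 → v ≡ 𝟎
      join (_ ∷ _) refl refl = refl
      cuts : ∀ x → cut (head ∘ κ) (cutᵥ (tail ∘ κ) g) x ≡ cutᵥ κ g x
      cuts x = by-cases (κ x)
        where
        by-cases : (v : V (suc e)) → (head v ≟F 0F) ⊙ (tail v ≟V 𝟎) ⊙ g x ≡ (v ≟V 𝟎) ⊙ g x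
        by-cases (a ∷ v) = nested (a ≟F 0F) (v ≟V 𝟎) ((a ∷ v) ≟V 𝟎)
          where
          nested : (d₁ : Dec (a ≡ 0F)) (d₂ : Dec (v ≡ 𝟎)) (d : Dec (a ∷ v ≡ 𝟎)) → d₁ ⊙ d₂ ⊙ g x ≡ d ⊙ g x
          nested (no a≢0)   d₂ d = sym (⊙-no d (a≢0 ∘ Vecₚ.∷-injectiveˡ) (g x))
          nested (yes refl) d₂ d = ⊙-cong d₂ d (cong (0F ∷_)) Vecₚ.∷-injectiveʳ refl

-- Spans and direct sum decompositions.

module Splitting (F : FiniteField) where
  open Vectors F
  private variable m : ℕ

  data Span (S : V m → Set) : V m → Set where
    zero : Span S 𝟎
    add  : ∀ a {s v} → S s → Span S v → Span S (a · s ⊕ v)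

  span-⊕ : {S : V m → Set} {u v : V m} → Span S u → Span S v → Span S (u ⊕ v)
  span-⊕ zero q = subst (Span _) (sym (⊕-identityˡ _)) q
  span-⊕ (add a s∈ p) q = subst (Span _) (sym (⊕-assoc _ _ _)) (add a s∈ (span-⊕ p q))

  span-· : {S : V m → Set} → ∀ b {v : V m} → Span S v → Span S (b · v)
  span-· b zero = subst (Span _) (sym (·-zeroʳ b)) zero
  span-· b (add a s∈ p) = subst (Span _) (trans (cong (_⊕ _) (·-assoc b a _)) (sym (·-distribˡ b _ _)))
                            (add (b *F a) s∈ (span-· b p))

  span-member : {S : V m → Set} {s : V m} → S s → Span S s
  span-member s∈ = subst (Span _) (trans (⊕-identityʳ _) (·-identity _)) (add 1F s∈ zero)

  span-⊆ : {S U : V m → Set} → Subspace U → U 𝟎 → (∀ {s} → S s → U s) → ∀ {v} → Span S v → U v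
  span-⊆ sub z S⊆U zero = z
  span-⊆ sub z S⊆U (add a s∈ p) = closed-⊕ sub (closed-· sub a (S⊆U s∈)) (span-⊆ sub z S⊆U p)

  -- A decomposition F^m = F^d ⊕ F^e given by its projections and injections. The first summand is
  -- then both a kernel, of `π₂`, and an image, of `ι₁`.
  record Split (m d e : ℕ) : Set where
    field
      π₁ : V m → V d
      π₂ : V m → V e
      ι₁ : V d → V m
      ι₂ : V e → V m
      π₁-linear : Linear π₁
      π₂-linear : Linear π₂
      ι₁-linear : Linear ι₁
      ι₂-linear : Linear ι₂
      π₁ι₁ : ∀ y → π₁ (ι₁ y) ≡ y
      π₂ι₁ : ∀ y → π₂ (ι₁ y) ≡ 𝟎
      π₁ι₂ : ∀ z → π₁ (ι₂ z) ≡ 𝟎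
      π₂ι₂ : ∀ z → π₂ (ι₂ z) ≡ z
      ιπ   : ∀ x → ι₁ (π₁ x) ⊕ ι₂ (π₂ x) ≡ x

    ι₁π₁ : ∀ x → π₂ x ≡ 𝟎 → ι₁ (π₁ x) ≡ x
    ι₁π₁ x π₂x≡𝟎 = trans (sym (⊕-identityʳ _))
      (trans (cong (ι₁ (π₁ x) ⊕_) (sym (trans (cong ι₂ π₂x≡𝟎) (map-𝟎 ι₂-linear)))) (ιπ x))

  open Split public

  -- The first summand is the span of `S`: `vanishes` is one inclusion, `generated` the other.
  record Adapted (S : V m → Set) : Set where
    field
      {d e}     : ℕ
      -- Delivered by the construction, which spares a proof that dimension is well defined.
      d+e≡m     : d + e ≡ m
      split     : Split m d e
      vanishes  : ∀ {s} → S s → π₂ split s ≡ 𝟎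
      generated : ∀ y → Span S (ι₁ split y)

  cons-linear : ∀ {e} (φ : V m → Carrier) (κ : V m → V e) → LinearForm φ → Linear κ → Linear (λ x → φ x ∷ κ x)
  cons-linear φ κ lφ lκ = record
    { map-⊕ = λ x y → cong₂ _∷_ (form-⊕ lφ x y) (map-⊕ lκ x y)
    ; map-· = λ a x → cong₂ _∷_ (form-· lφ a x) (map-· lκ a x) }

  ∘-linear : ∀ {l n} {κ : V m → V l} {κ′ : V l → V n} → Linear κ′ → Linear κ → Linear (κ′ ∘ κ)
  ∘-linear {κ′ = κ′} lκ′ lκ = record
    { map-⊕ = λ x y → trans (cong κ′ (map-⊕ lκ x y)) (map-⊕ lκ′ _ _)
    ; map-· = λ a x → trans (cong κ′ (map-· lκ a x)) (map-· lκ′ _ _) }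

  id-linear : Linear {m} id
  id-linear = record { map-⊕ = λ _ _ → refl ; map-· = λ _ _ → refl }

  zero-form : LinearForm {m} (λ _ → 0F)
  zero-form = record { form-⊕ = λ _ _ → sym (+-identityˡ 0F) ; form-· = λ a _ → sym (zeroʳ a) }

  split₀ : Split 0 0 0
  split₀ = record
    { π₁ = id ; π₂ = id ; ι₁ = id ; ι₂ = id
    ; π₁-linear = id-linear ; π₂-linear = id-linear ; ι₁-linear = id-linear ; ι₂-linear = id-linear
    ; π₁ι₁ = λ _ → refl ; π₂ι₁ = λ { [] → refl } ; π₁ι₂ = λ { [] → refl } ; π₂ι₂ = λ _ → refl
    ; ιπ = λ { [] → refl } }

  splitʳ : ∀ {d e} → Split m d e → Split (suc m) d (suc e)
  splitʳ s = record
    { π₁ = π₁ s ∘ tail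
    ; π₂ = λ x → head x ∷ π₂ s (tail x)
    ; ι₁ = λ y → 0F ∷ ι₁ s y
    ; ι₂ = λ z → head z ∷ ι₂ s (tail z)
    ; π₁-linear = ∘-linear (π₁-linear s) tl
    ; π₂-linear = cons-linear _ _ (head-form id-linear) (∘-linear (π₂-linear s) tl)
    ; ι₁-linear = cons-linear _ _ zero-form (ι₁-linear s)
    ; ι₂-linear = cons-linear _ _ (head-form id-linear) (∘-linear (ι₂-linear s) tl)
    ; π₁ι₁ = π₁ι₁ s
    ; π₂ι₁ = λ y → cong (0F ∷_) (π₂ι₁ s y)
    ; π₁ι₂ = λ z → π₁ι₂ s (tail z)
    ; π₂ι₂ = λ { (a ∷ z) → cong (a ∷_) (π₂ι₂ s z) }
    ; ιπ = λ { (a ∷ x) → cong₂ _∷_ (+-identityˡ a) (ιπ s x) } }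
    where
    tl : ∀ {n} → Linear {suc n} tail
    tl = tail-linear id-linear

  -- `shear` is the projection along the vector (1, s) onto the vectors with first coordinate 0;
  -- `unshear` recovers a vector from its first coordinate and its projection.
  module Shear (s : V m) where
    shear : V (suc m) → V m
    shear x = tail x ⊕ (-F head x) · s

    shear-linear : Linear shear
    shear-linear = record
      { map-⊕ = λ { (a ∷ x) (b ∷ y) → trans (cong ((x ⊕ y) ⊕_)
          (trans (cong (_· s) (sym (-‿+-comm a b))) (·-distribʳ _ _ s))) (⊕-interchange x y _ _) }
      ; map-· = λ { c (a ∷ x) → trans (cong (c · x ⊕_)
          (trans (cong (_· s) (-‿distribʳ-* c a)) (·-assoc c _ s))) (sym (·-distribˡ c x _)) } }

    unshear : Carrier → V m → V (suc m)
    unshear a v = a ∷ (a · s ⊕ v)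

    neg-cancel : ∀ a → a · s ⊕ (-F a) · s ≡ 𝟎
    neg-cancel a = trans (sym (·-distribʳ a (-F a) s)) (trans (cong (_· s) (-‿inverseʳ a)) (·-zeroˡ s))

    shear-unshear : ∀ a v → shear (unshear a v) ≡ v
    shear-unshear a v = trans (cong (_⊕ (-F a) · s) (⊕-comm (a · s) v))
      (trans (⊕-assoc v _ _) (trans (cong (v ⊕_) (neg-cancel a)) (⊕-identityʳ v)))

    unshear-shear : ∀ x → unshear (head x) (shear x) ≡ x
    unshear-shear (a ∷ x) = cong (a ∷_) (trans (⊕-comm (a · s) _) (trans (⊕-assoc x _ _)
      (trans (cong (x ⊕_) (trans (⊕-comm _ (a · s)) (neg-cancel a))) (⊕-identityʳ x))))

    splitˡ : ∀ {d e} → Split m d e → Split (suc m) (suc d) e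
    splitˡ t = record
      { π₁ = λ x → head x ∷ π₁ t (shear x)
      ; π₂ = π₂ t ∘ shear
      ; ι₁ = λ y → unshear (head y) (ι₁ t (tail y))
      ; ι₂ = λ z → 0F ∷ ι₂ t z
      ; π₁-linear = cons-linear _ _ (head-form id-linear) (∘-linear (π₁-linear t) shear-linear)
      ; π₂-linear = ∘-linear (π₂-linear t) shear-linear
      ; ι₁-linear = cons-linear _ _ (head-form id-linear) record
          { map-⊕ = λ { (a ∷ x) (b ∷ y) → trans (cong₂ _⊕_ (·-distribʳ a b s) (map-⊕ (ι₁-linear t) x y))
                                                (⊕-interchange _ _ _ _) }
          ; map-· = λ { c (a ∷ x) → trans (cong₂ _⊕_ (·-assoc c a s) (map-· (ι₁-linear t) c x))
                                          (sym (·-distribˡ c _ _)) } }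
      ; ι₂-linear = cons-linear _ _ zero-form (ι₂-linear t)
      ; π₁ι₁ = λ { (a ∷ y) → cong (a ∷_) (trans (cong (π₁ t) (shear-unshear a _)) (π₁ι₁ t y)) }
      ; π₂ι₁ = λ { (a ∷ y) → trans (cong (π₂ t) (shear-unshear a _)) (π₂ι₁ t y) }
      ; π₁ι₂ = λ z → cong (0F ∷_) (trans (cong (π₁ t) (shear-0∷ (ι₂ t z))) (π₁ι₂ t z))
      ; π₂ι₂ = λ z → trans (cong (π₂ t) (shear-0∷ (ι₂ t z))) (π₂ι₂ t z)
      ; ιπ = λ x → trans (cong₂ _∷_ (+-identityʳ (head x))
                (trans (⊕-assoc _ _ _) (cong (head x · s ⊕_) (ιπ t (shear x)))))
              (unshear-shear x) }
      where
      shear-0∷ : ∀ v → shear (0F ∷ v) ≡ v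
      shear-0∷ v = trans (cong (v ⊕_) (trans (cong (_· s) -0#≈0#) (·-zeroˡ s))) (⊕-identityʳ v)

  -- Row reduction, one coordinate at a time: look for a member of `S` with nonzero first
  -- coordinate. Without one, this coordinate goes to the complement; with one, that member is a
  -- pivot, and the elimination continues with the projection of `S` along it.
  adapted : ∀ m (S : V m → Set) → (∀ v → Dec (S v)) → Adapted S
  adapted zero S S? = record { d+e≡m = refl ; split = split₀ ; vanishes = λ { {[]} _ → refl } ; generated = λ { [] → zero } }
  adapted (suc m) S S? with searchV (suc m) (λ v → S? v ×-dec ¬? (head v ≟F 0F))
  ... | no ¬pivot = record
    { d+e≡m = trans (ℕₚ.+-suc _ _) (cong suc (d+e≡m A)) ; split = splitʳ (split A)
    ; vanishes = λ {s} s∈ → vanish s s∈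
    ; generated = λ y → lift (generated A y) }
    where
    open Adapted
    A = adapted m (S ∘ (0F ∷_)) (λ v → S? (0F ∷ v))
    vanish : ∀ s → S s → head s ∷ π₂ (split A) (tail s) ≡ 𝟎
    vanish (a ∷ v) s∈ with decidable-stable (a ≟F 0F) (λ a≢0 → ¬pivot (a ∷ v , s∈ , a≢0))
    ... | refl = cong (0F ∷_) (vanishes A s∈)
    lift : ∀ {v} → Span (S ∘ (0F ∷_)) v → Span S (0F ∷ v)
    lift zero = zero
    lift (add b s∈ p) = subst (Span S) (cong (_∷ _) (trans (cong (_+F 0F) (zeroʳ b)) (+-identityʳ 0F))) (add b s∈ (lift p))
  ... | yes (a ∷ s , s∈ , a≢0) = record
    { d+e≡m = cong suc (d+e≡m A) ; split = splitˡ (split A)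
    ; vanishes = λ {x} x∈ → vanishes A (head x , subst S (sym (unshear-shear x)) x∈)
    ; generated = λ { (b ∷ y) → subst (Span S) (unshear-sum b _) (span-⊕ (span-· b pivot) (lift (generated A y))) } }
    where
    open Adapted
    open Shear (inv a a≢0 · s)
    -- The image of `S` under `shear`, written through preimages so that a search over the scalar
    -- `b` decides it.
    S′ : V m → Set
    S′ v = ∃ λ b → S (unshear b v)
    A = adapted m S′ (λ v → Enumeration.search 𝔽 (λ b → S? (unshear b v)))
    pivot : Span S (1F ∷ inv a a≢0 · s)
    pivot = subst (λ z → Span S (z ∷ inv a a≢0 · s)) (*-inverseˡ a a≢0) (span-· (inv a a≢0) (span-member s∈))
    unshear-sum : ∀ b v → b · (1F ∷ inv a a≢0 · s) ⊕ (0F ∷ v) ≡ unshear b v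
    unshear-sum b v = cong (_∷ (b · inv a a≢0 · s ⊕ v)) (trans (+-identityʳ _) (*-identityʳ b))
    lift : ∀ {v} → Span S′ v → Span S (0F ∷ v)
    lift zero = zero
    lift (add c {s = t} {v} (b , t∈) p) =
      subst (Span S) eq (span-⊕ (span-· c (span-⊕ (span-member t∈) (span-· (-F b) pivot))) (lift p))
      where
      clear : unshear b t ⊕ (-F b) · (1F ∷ inv a a≢0 · s) ≡ 0F ∷ t
      clear = cong₂ _∷_ (trans (cong (b +F_) (*-identityʳ _)) (-‿inverseʳ b)) (shear-unshear b t)
      eq : c · (unshear b t ⊕ (-F b) · (1F ∷ inv a a≢0 · s)) ⊕ (0F ∷ v) ≡ 0F ∷ (c · t ⊕ v)
      eq = trans (cong (λ w → c · w ⊕ (0F ∷ v)) clear) (cong (_∷ _) (trans (+-identityʳ _) (zeroʳ c)))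

  enlarge : ∀ {d e} → Split m d (suc e) → Split m (suc d) e
  enlarge s = record
    { π₁ = λ x → head (π₂ s x) ∷ π₁ s x
    ; π₂ = tail ∘ π₂ s
    ; ι₁ = λ y → ι₁ s (tail y) ⊕ ι₂ s (head y ∷ 𝟎)
    ; ι₂ = λ z → ι₂ s (0F ∷ z)
    ; π₁-linear = cons-linear _ _ (head-form (π₂-linear s)) (π₁-linear s)
    ; π₂-linear = tail-linear (π₂-linear s)
    ; ι₁-linear = record
        { map-⊕ = λ { (a ∷ x) (b ∷ y) → trans (cong₂ _⊕_ (map-⊕ (ι₁-linear s) x y)
            (trans (cong (λ z → ι₂ s (_ ∷ z)) (sym (⊕-identityˡ 𝟎))) (map-⊕ (ι₂-linear s) (a ∷ 𝟎) (b ∷ 𝟎))))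
            (⊕-interchange _ _ _ _) }
        ; map-· = λ { c (a ∷ x) → trans (cong₂ _⊕_ (map-· (ι₁-linear s) c x)
            (trans (cong (λ z → ι₂ s (_ ∷ z)) (sym (·-zeroʳ c))) (map-· (ι₂-linear s) c (a ∷ 𝟎))))
            (sym (·-distribˡ c _ _)) } }
    ; ι₂-linear = ∘-linear (ι₂-linear s) (cons-linear _ _ zero-form id-linear)
    ; π₁ι₁ = λ { (a ∷ y) → cong₂ _∷_ (cong head (π₂ι a y))
        (trans (map-⊕ (π₁-linear s) _ _) (trans (cong₂ _⊕_ (π₁ι₁ s y) (π₁ι₂ s _)) (⊕-identityʳ y))) }
    ; π₂ι₁ = λ { (a ∷ y) → cong tail (π₂ι a y) }
    ; π₁ι₂ = λ z → cong₂ _∷_ (cong head (π₂ι₂ s _)) (π₁ι₂ s _)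
    ; π₂ι₂ = λ z → cong tail (π₂ι₂ s _)
    ; ιπ = λ x → trans (⊕-assoc _ _ _) (trans (cong (ι₁ s (π₁ s x) ⊕_)
        (trans (sym (map-⊕ (ι₂-linear s) _ _)) (cong (ι₂ s) (recombine (π₂ s x))))) (ιπ s x)) }
    where
    π₂ι : ∀ a y → π₂ s (ι₁ s y ⊕ ι₂ s (a ∷ 𝟎)) ≡ a ∷ 𝟎
    π₂ι a y = trans (map-⊕ (π₂-linear s) _ _) (trans (cong₂ _⊕_ (π₂ι₁ s y) (π₂ι₂ s _)) (⊕-identityˡ _))
    recombine : ∀ {e} (z : V (suc e)) → (head z ∷ 𝟎) ⊕ (0F ∷ tail z) ≡ z
    recombine (a ∷ z) = cong₂ _∷_ (+-identityʳ a) (⊕-identityˡ z)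

  -- The support may span less than the dimension demanded of the final subspace; the missing
  -- dimensions are borrowed from the complement.
  enlarge-to : ∀ {d e r} {S : V m → Set} → d + e ≡ m → d ≤′ r → r ≤ m → (s : Split m d e) →
               (∀ {x} → S x → π₂ s x ≡ 𝟎) →
               Σ ℕ λ e′ → r + e′ ≡ m × Σ (Split m r e′) λ s′ → ∀ {x} → S x → π₂ s′ x ≡ 𝟎
  enlarge-to d+e≡m ≤′-refl r≤m s vanish = _ , d+e≡m , s , vanish
  enlarge-to {r = suc r} d+e≡m (≤′-step d≤r) r<m s vanish with enlarge-to d+e≡m d≤r (ℕₚ.<⇒≤ r<m) s vanish
  ... | zero  , r+0≡m , _  , _       = ⊥-elim (ℕₚ.<-irrefl (trans (sym (ℕₚ.+-identityʳ r)) r+0≡m) r<m)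
  ... | suc e , r+e≡m , s′ , vanish′ = e , trans (sym (ℕₚ.+-suc r e)) r+e≡m , enlarge s′ , λ x∈ → cong tail (vanish′ x∈)

∣m+n∣n⇒∣m : ∀ {d m n} → d ∣ m + n → d ∣ n → d ∣ m
∣m+n∣n⇒∣m {d} {m} {n} d∣m+n = ∣m+n∣m⇒∣n (subst (d ∣_) (ℕₚ.+-comm m n) d∣m+n)

-- Codewords as functions on vectors, and their weights.

module Codewords (F : FiniteField) {p : ℕ} (p∣q : p ∣ FiniteField.order F) where
  open Vectors F
  open Sums p∣q
  open Splitting F
  open Enumeration using (all?; search; covers)

  private variable m : ℕ

  Supp : (V m → ℕ) → V m → Set
  Supp f v = ¬ p ∣ f v

  supp? : (f : V m → ℕ) → ∀ v → Dec (Supp f v)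
  supp? f v = ¬? (p ∣? f v)

  -- Counts vectors, not points: for a codeword it is q - 1 times the weight, so sizes compare as
  -- weights do.
  size : (V m → ℕ) → ℕ
  size f = ∑ (vectors _) (λ v → supp? f v ⊙ 1)

  -- Count the support of `f` by the fibres of `π`. Every support vector of `h` has a nonempty
  -- fibre, and the fibre of `π P` is in excess: it has two members, or it lies over a zero of `h`.
  size-< : (h f : V m → ℕ) (π : V m → V m) →
           (∀ x → Supp h x → ∃ λ v → Supp f v × x ≡ π v) →
           ∀ P → Supp f P → (∃ λ P′ → P′ ≢ P × Supp f P′ × π P ≡ π P′) ⊎ p ∣ h (π P) →
           size h < size f
  size-< {m} h f π cover P P∈ strict =
    subst (size h <_) (sym (∑-fibre (𝕍 m) (vectors m) π _))
      (∑-mono-< bound (covers (𝕍 m) (π P)) (strictly strict))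
    where
    fibre : V m → V m → ℕ
    fibre x v = (x ≟V π v) ⊙ supp? f v ⊙ 1
    in-fibre : ∀ {x v} → Supp f v → x ≡ π v → fibre x v ≡ 1
    in-fibre {x} {v} v∈ eq = trans (⊙-yes (x ≟V π v) eq _) (⊙-yes (supp? f v) v∈ 1)
    fibre≥1 : ∀ {x v} → Supp f v → x ≡ π v → 1 ≤ ∑ (vectors m) (fibre x)
    fibre≥1 {x} {v} v∈ eq = subst (_≤ ∑ (vectors m) (fibre x)) (in-fibre v∈ eq) (term≤∑ (fibre x) (covers (𝕍 m) v))
    bound : ∀ x → supp? h x ⊙ 1 ≤ ∑ (vectors m) (fibre x)
    bound x with supp? h x
    ... | no _   = z≤n
    ... | yes x∈ = let v , v∈ , eq = cover x x∈ in fibre≥1 v∈ eq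
    ⊙1≤1 : ∀ {Q : Set} (d : Dec Q) → d ⊙ 1 ≤ 1
    ⊙1≤1 (yes _) = ℕₚ.≤-refl
    ⊙1≤1 (no _)  = z≤n
    strictly : _ → supp? h (π P) ⊙ 1 < ∑ (vectors m) (fibre (π P))
    strictly (inj₂ p∣h) = subst (_< ∑ (vectors m) (fibre (π P)))
      (sym (⊙-no (supp? h (π P)) (λ ∤ → ∤ p∣h) 1)) (fibre≥1 P∈ refl)
    strictly (inj₁ (P′ , P′≢P , P′∈ , eq)) = ℕₚ.≤-trans (s≤s (⊙1≤1 (supp? h (π P)))) (begin
      2
        ≡⟨ cong₂ _+_ (single-≟ (𝕍 m) P (λ _ → 1)) (single-≟ (𝕍 m) P′ (λ _ → 1)) ⟨
      ∑ (vectors m) (λ v → (v ≟V P) ⊙ 1) + ∑ (vectors m) (λ v → (v ≟V P′) ⊙ 1)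
        ≡⟨ ∑-+ (vectors m) _ _ ⟨
      ∑ (vectors m) (λ v → (v ≟V P) ⊙ 1 + (v ≟V P′) ⊙ 1)
        ≤⟨ ∑-mono (vectors m) both ⟩
      ∑ (vectors m) (fibre (π P)) ∎)
      where
      open ℕₚ.≤-Reasoning
      both : ∀ v → (v ≟V P) ⊙ 1 + (v ≟V P′) ⊙ 1 ≤ fibre (π P) v
      both v with v ≟V P | v ≟V P′
      ... | yes refl | yes refl = ⊥-elim (P′≢P refl)
      ... | yes refl | no _     = ℕₚ.≤-reflexive (sym (in-fibre P∈ refl))
      ... | no _     | yes refl = ℕₚ.≤-reflexive (sym (in-fibre P′∈ eq))
      ... | no _     | no _     = z≤n

  -- Values are natural numbers read mod p, and `j` is the linear dimension, one more than the
  -- projective dimension of the generators of the code.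
  record Codeword (j : ℕ) (f : V m → ℕ) : Set where
    field
      scale    : ∀ a → a ≢ 0F → ∀ v → f (a · v) ≡ f v
      origin   : p ∣ f 𝟎
      balanced : Balanced (λ _ → ⊤) j f

  open Codeword

  -- The kernel of `φ` will be the hyperplane onto which a word is projected from `R`.
  separate : (R : V m) → R ≢ 𝟎 → ∃ λ φ → LinearForm φ × φ R ≡ 1F
  separate [] R≢𝟎 = ⊥-elim (R≢𝟎 refl)
  separate (a ∷ R) R≢𝟎 with a ≟F 0F
  ... | yes refl = let φ , lin , φR = separate R (R≢𝟎 ∘ cong (0F ∷_)) in
    φ ∘ tail , record { form-⊕ = λ { (_ ∷ x) (_ ∷ y) → form-⊕ lin x y } ; form-· = λ { b (_ ∷ x) → form-· lin b x } } , φR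
  ... | no a≢0 = (λ x → head x *F inv a a≢0) , record
    { form-⊕ = λ { (x ∷ _) (y ∷ _) → distribʳ _ x y } ; form-· = λ { b (x ∷ _) → *-assoc b x _ } } , *-inverseʳ a a≢0

  another-term : ∀ {g : Carrier → ℕ} → p ∣ ∑ elements g → ¬ p ∣ g 0F → ∃ λ y → y ≢ 0F × ¬ p ∣ g y
  another-term {g} p∣∑ p∤g0 with search 𝔽 (λ y → ¬? (y ≟F 0F) ×-dec ¬? (p ∣? g y))
  ... | yes found = found
  ... | no none = ⊥-elim (p∤g0 (subst (p ∣_) (single-≟ 𝔽 0F g)
      (∣m+n∣m⇒∣n (subst (p ∣_) (trans (∑-cong elements split-off) (∑-+ elements _ _)) p∣∑)
        (∣-∑ elements λ y → ∣-⊙ (¬? (y ≟F 0F)) λ y≢0 → decidable-stable (p ∣? g y) λ p∤ → none (y , y≢0 , p∤)))))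
    where
    split-off : ∀ y → g y ≡ ¬? (y ≟F 0F) ⊙ g y + (y ≟F 0F) ⊙ g y
    split-off y with y ≟F 0F
    ... | yes _ = refl
    ... | no _  = sym (ℕₚ.+-identityʳ _)

  -- The span W of the support is the kernel of `κ`; `supp⊆ker` and `ker⊆span` are the two
  -- inclusions. The generators of the code have projective dimension k + 1, so `e<k` says that W is
  -- too large. The module derives a contradiction, reached in `no-hyperplane`.
  module Minimal {m k e : ℕ} (f : V m → ℕ) (code : Codeword (suc (suc k)) f)
                 (minimal : (h : V m → ℕ) → Codeword (suc (suc k)) h → ∃ (Supp h) → size f ≤ size h)
                 (κ : V m → V e) (κ-linear : Linear κ)
                 (supp⊆ker : {v : V m} → Supp f v → κ v ≡ 𝟎)
                 (ker⊆span : {v : V m} → κ v ≡ 𝟎 → Span (Supp f) v)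
                 (e<k : suc e ≤ k) (nonzero : ∃ (Supp f)) where

    no-smaller : ∀ {h} → Codeword (suc (suc k)) h → size h < size f → ∀ x → p ∣ h x
    no-smaller {h} h-code small x = decidable-stable (p ∣? h x)
      λ p∤hx → ℕₚ.<⇒≱ {size h} {size f} small (minimal h h-code (x , p∤hx))

    S-scale : ∀ {a v} → a ≢ 0F → Supp f v → Supp f (a · v)
    S-scale a≢0 v∈ p∣ = v∈ (subst (p ∣_) (scale code _ a≢0 _) p∣)

    supp≢𝟎 : ∀ {v} → Supp f v → v ≢ 𝟎
    supp≢𝟎 v∈ refl = v∈ (origin code)

    line : V m → V m → ℕ
    line R x = ∑ elements (λ y → f (x ⊕ y · R))

    -- The sum of the word over the points of the projective line ⟨R, x⟩, for independent R and x in
    -- the kernel of κ; the last term accounts for R, and vanishes off the kernel as the word does.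
    projection : V m → V m → ℕ
    projection R x = line R x + cutᵥ κ (λ _ → f R) x

    -- The line sums over ⟨vs⟩ add up to the sum of `f` over ⟨R, vs⟩. The correction is a constant
    -- cut to the kernel of `e` equations, and e ≤ k leaves at least one dimension, over which a
    -- constant sums to 0 mod p.
    projection-balanced : ∀ R → Balanced (λ _ → ⊤) (suc k) (projection R)
    projection-balanced R vs vs∈ = subst (p ∣_) (sym (spanSum-+ vs (line R) _ 𝟎))
      (∣m∣n⇒∣m+n
        (subst (p ∣_) (sym (trans (spanSum-∑ vs (λ y x → f (x ⊕ y · R)) 𝟎)
                                  (∑-cong elements λ y → spanSum-translate vs f (y · R) 𝟎)))
          (balanced code (R ∷ vs) (tt ∷ vs∈)))
        (balanced-≤ whole (ℕₚ.≤⇒≤′ (subst (_≤ k) (sym (ℕₚ.+-identityʳ e)) (ℕₚ.<⇒≤ e<k)))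
          (balanced-cutᵥ whole κ-linear {j = 0} λ { (_ ∷ []) _ → p∣∑-const (f R) }) vs vs∈))

    projection-scale : ∀ R a → a ≢ 0F → ∀ x → projection R (a · x) ≡ projection R x
    projection-scale R a a≢0 x = cong₂ _+_
      (trans (∑-cong elements λ y → trans (cong f (factor y)) (scale code a a≢0 _))
             (∑-reindex 𝔽 𝔽 (inv a a≢0 *F_) (a *F_)
               (λ y → trans (sym (*-assoc a _ y)) (trans (cong (_*F y) (*-inverseʳ a a≢0)) (*-identityˡ y)))
               (λ y → trans (sym (*-assoc _ a y)) (trans (cong (_*F y) (*-inverseˡ a a≢0)) (*-identityˡ y)))
               (λ y → f (x ⊕ y · R))))
      (⊙-cong (κ (a · x) ≟V 𝟎) (κ x ≟V 𝟎)
        (λ eq → trans (sym (inv·· a a≢0 (κ x))) (trans (cong (inv a a≢0 ·_) (trans (sym (map-· κ-linear a x)) eq)) (·-zeroʳ _)))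
        (λ eq → trans (map-· κ-linear a x) (trans (cong (a ·_) eq) (·-zeroʳ a))) refl)
      where
      factor : ∀ y → a · x ⊕ y · R ≡ a · (x ⊕ (inv a a≢0 *F y) · R)
      factor y = trans (cong (a · x ⊕_) (trans (sym (·inv· a a≢0 (y · R))) (cong (a ·_) (sym (·-assoc _ y R)))))
                       (sym (·-distribˡ a x _))

    -- Hence the projection is determined by its values on any hyperplane that misses `R`.
    projection-shift : ∀ {R} → κ R ≡ 𝟎 → ∀ c x → projection R (x ⊕ c · R) ≡ projection R x
    projection-shift {R} κR c x = cong₂ _+_
      (trans (∑-cong elements λ y → cong f (trans (⊕-assoc x _ _) (cong (x ⊕_) (sym (·-distribʳ c y R)))))
             (∑-reindex 𝔽 𝔽 (c +F_) ((-F c) +F_)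
               (λ y → trans (sym (+-assoc _ c y)) (trans (cong (_+F y) (-‿inverseˡ c)) (+-identityˡ y)))
               (λ y → trans (sym (+-assoc c _ y)) (trans (cong (_+F y) (-‿inverseʳ c)) (+-identityˡ y)))
               (λ y → f (x ⊕ y · R))))
      (cong (λ z → (z ≟V 𝟎) ⊙ f R)
        (trans (map-⊕ κ-linear x _) (trans (cong (κ x ⊕_)
          (trans (map-· κ-linear c R) (trans (cong (c ·_) κR) (·-zeroʳ c)))) (⊕-identityʳ _))))

    -- The q - 1 nonzero multiples of `R` and the correction term give q copies of `f R`; only `f 𝟎`
    -- is left over.
    projection-origin : ∀ R → p ∣ projection R 𝟎
    projection-origin R = subst (p ∣_) (sym total) (∣m∣n⇒∣m+n (p∣∑-const (f R)) (origin code))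
      where
      pointwise : ∀ y → f (𝟎 ⊕ y · R) + (y ≟F 0F) ⊙ f R ≡ f R + (y ≟F 0F) ⊙ f 𝟎
      pointwise y with y ≟F 0F
      ... | yes refl = trans (cong (λ z → f z + f R) (trans (⊕-identityˡ _) (·-zeroˡ R))) (ℕₚ.+-comm (f 𝟎) (f R))
      ... | no y≢0   = cong (_+ 0) (trans (cong f (⊕-identityˡ _)) (scale code y y≢0 R))
      total : projection R 𝟎 ≡ ∑ elements (λ _ → f R) + f 𝟎
      total = begin
        line R 𝟎 + cutᵥ κ (λ _ → f R) 𝟎
          ≡⟨ cong (line R 𝟎 +_) (trans (⊙-yes (κ 𝟎 ≟V 𝟎) (map-𝟎 κ-linear) (f R)) (sym (single-≟ 𝔽 0F (λ _ → f R)))) ⟩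
        line R 𝟎 + ∑ elements (λ y → (y ≟F 0F) ⊙ f R)
          ≡⟨ ∑-+ elements _ _ ⟨
        ∑ elements (λ y → f (𝟎 ⊕ y · R) + (y ≟F 0F) ⊙ f R)
          ≡⟨ ∑-cong elements pointwise ⟩
        ∑ elements (λ y → f R + (y ≟F 0F) ⊙ f 𝟎)
          ≡⟨ ∑-+ elements _ _ ⟩
        ∑ elements (λ _ → f R) + ∑ elements (λ y → (y ≟F 0F) ⊙ f 𝟎)
          ≡⟨ cong (∑ elements (λ _ → f R) +_) (single-≟ 𝔽 0F (λ _ → f 𝟎)) ⟩
        ∑ elements (λ _ → f R) + f 𝟎 ∎
        where open ≡-Reasoning

    -- The projection is balanced one dimension lower than `f`; cutting it to a hyperplane restores
    -- that dimension.
    cut-projection-code : ∀ {φ} → LinearForm φ → ∀ R → Codeword (suc (suc k)) (cut φ (projection R))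
    cut-projection-code {φ} lin R = record
      { scale = λ a a≢0 x → ⊙-cong (φ (a · x) ≟F 0F) (φ x ≟F 0F)
          (λ eq → trans (sym (*-identityˡ _)) (trans (cong (_*F φ x) (sym (*-inverseˡ a a≢0)))
                    (trans (*-assoc _ a _) (trans (cong (inv a a≢0 *F_) (trans (sym (form-· lin a x)) eq)) (zeroʳ _)))))
          (λ eq → trans (form-· lin a x) (trans (cong (a *F_) eq) (zeroʳ a)))
          (projection-scale R a a≢0 x)
      ; origin = ∣-⊙ (φ 𝟎 ≟F 0F) (λ _ → projection-origin R)
      ; balanced = balanced-cut whole lin (balanced-cong (λ _ → tt) (λ _ → refl) (projection-balanced R)) }

    -- `π` projects from `R` onto a hyperplane. By `meets`, the projected support comes from the
    -- support of `f`; either `P` and P - R fall together or `P` is lost. So the cut projection is a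
    -- smaller codeword and vanishes, and shifting along `R` spreads this to all vectors.
    projection-vanishes : ∀ {R} → R ≢ 𝟎 → κ R ≡ 𝟎 →
      (∀ x → ¬ p ∣ projection R x → ∃ λ y → Supp f (x ⊕ y · R)) →
      ∀ P → Supp f P → Supp f (P ⊕ ⊖ R) ⊎ p ∣ projection R P →
      ∀ x → p ∣ projection R x
    projection-vanishes {R} R≢𝟎 κR meets P P∈ strict x =
      subst (p ∣_) (trans (on-axis (π x) (φπ x)) (projection-shift κR _ x)) (no-smaller (cut-projection-code lin R) smaller (π x))
      where
      φ = proj₁ (separate R R≢𝟎)
      lin = proj₁ (proj₂ (separate R R≢𝟎))
      φR = proj₂ (proj₂ (separate R R≢𝟎))
      π : V m → V m
      π v = v ⊕ (-F φ v) · R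
      φ-line : ∀ v y → φ (v ⊕ y · R) ≡ φ v +F y
      φ-line v y = trans (form-⊕ lin v _) (cong (φ v +F_) (trans (form-· lin y R) (trans (cong (y *F_) φR) (*-identityʳ y))))
      φπ : ∀ v → φ (π v) ≡ 0F
      φπ v = trans (φ-line v _) (-‿inverseʳ (φ v))
      π-line : ∀ v y → π v ≡ π (v ⊕ y · R)
      π-line v y = sym (trans (⊕-assoc v _ _) (cong (v ⊕_) (trans (sym (·-distribʳ y _ R)) (cong (_· R) coefficient))))
        where
        coefficient : y +F (-F φ (v ⊕ y · R)) ≡ -F φ v
        coefficient = trans (cong (λ z → y +F (-F z)) (φ-line v y)) (trans (cong (y +F_) (sym (-‿+-comm _ y)))
          (trans (cong (y +F_) (+F-comm _ _)) (trans (sym (+-assoc y _ _))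
            (trans (cong (_+F (-F φ v)) (-‿inverseʳ y)) (+-identityˡ _)))))
      π-axis : ∀ v → φ v ≡ 0F → π v ≡ v
      π-axis v φv = trans (cong (v ⊕_) (trans (cong (_· R) (trans (cong -F_ φv) -0#≈0#)) (·-zeroˡ R))) (⊕-identityʳ v)
      on-axis : ∀ v → φ v ≡ 0F → cut φ (projection R) v ≡ projection R v
      on-axis v φv = ⊙-yes (φ v ≟F 0F) φv _
      cover : ∀ v → Supp (cut φ (projection R)) v → ∃ λ u → Supp f u × v ≡ π u
      cover v v∈ = let y , u∈ = meets v (v∈ ∘ λ p∣ → ∣-⊙ (φ v ≟F 0F) (λ _ → p∣))
                       φv = decidable-stable (φ v ≟F 0F) λ φv≢0 → v∈ (∣-⊙ (φ v ≟F 0F) (⊥-elim ∘ φv≢0))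
                   in v ⊕ y · R , u∈ , trans (sym (π-axis v φv)) (π-line v y)
      collapse : Supp f (P ⊕ ⊖ R) ⊎ p ∣ projection R P →
                 (∃ λ P′ → P′ ≢ P × Supp f P′ × π P ≡ π P′) ⊎ p ∣ cut φ (projection R) (π P)
      collapse (inj₁ P′∈) = inj₁ (P ⊕ ⊖ R , moved , P′∈ , π-line P _)
        where
        moved : P ⊕ ⊖ R ≢ P
        moved eq = -1≢0 (+-cancelˡ (φ P) _ _ (trans (sym (φ-line P _)) (trans (cong φ eq) (sym (+-identityʳ _)))))
      collapse (inj₂ p∣) = inj₂ (∣-⊙ (φ (π P) ≟F 0F) λ _ → subst (p ∣_) (sym (projection-shift κR _ P)) p∣)
      smaller : size (cut φ (projection R)) < size f
      smaller = size-< _ f π cover P P∈ (collapse strict)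

    ker-κ : ∀ {u v} → κ u ≡ 𝟎 → κ v ≡ 𝟎 → κ (u ⊕ v) ≡ 𝟎
    ker-κ = closed-⊕ (ker κ-linear)

    -- Since supports are closed under nonzero scalars, P + P′ stands for any further point of the
    -- secant. The two support vectors that fall together are `P` and P - R = -P′, and the
    -- correction term vanishes as `R` is not in the support.
    line-secant : ∀ {P P′} → Supp f P → Supp f P′ → ¬ Supp f (P ⊕ P′) → ∀ x → p ∣ line (P ⊕ P′) x
    line-secant {P} {P′} P∈ P′∈ R∉ x with (P ⊕ P′) ≟V 𝟎
    ... | yes R≡𝟎 = subst (p ∣_) (∑-cong elements λ y → cong f
            (sym (trans (cong (x ⊕_) (trans (cong (y ·_) R≡𝟎) (·-zeroʳ y))) (⊕-identityʳ x)))) (p∣∑-const (f x))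
    ... | no R≢𝟎 = ∣m+n∣n⇒∣m (projection-vanishes R≢𝟎 (ker-κ (supp⊆ker P∈) (supp⊆ker P′∈)) meets P P∈
                      (inj₁ (subst (Supp f) (sym difference) (S-scale -1≢0 P′∈))) x) (p∣cut x)
      where
      R = P ⊕ P′
      p∣cut : ∀ x → p ∣ cutᵥ κ (λ _ → f R) x
      p∣cut x = ∣-⊙ (κ x ≟V 𝟎) λ _ → decidable-stable (p ∣? f R) R∉
      difference : P ⊕ ⊖ R ≡ ⊖ P′
      difference = trans (cong (P ⊕_) (·-distribˡ _ P P′)) (trans (sym (⊕-assoc P _ _))
        (trans (cong (_⊕ ⊖ P′) (⊖-inverseʳ P)) (⊕-identityˡ _)))
      meets : ∀ x → ¬ p ∣ projection R x → ∃ λ y → Supp f (x ⊕ y · R)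
      meets x p∤ with all? 𝔽 (λ y → p ∣? f (x ⊕ y · R))
      ... | inj₁ found = found
      ... | inj₂ none  = ⊥-elim (p∤ (∣m∣n⇒∣m+n (∣-∑ elements none) (p∣cut x)))

    -- Coefficients are absorbed into `P` and `P′`. The zero vector is included, as s + (-s).
    Secant : V m → Set
    Secant v = Supp f v ⊎ ∃ λ P → ∃ λ P′ → Supp f P × Supp f P′ × v ≡ P ⊕ P′

    -- If Y = P + P′ is not in the support, the line joining `X` to `Y` has sum 0, so besides `X` it
    -- carries another support vector Z = X + yY with y nonzero. Then X + Y = (1 - 1/y) X + (1/y) Z
    -- lies on the secant XZ.
    secant-⊕ : ∀ {X Y} → Supp f X → Secant Y → Secant (X ⊕ Y)
    secant-⊕ X∈ (inj₁ Y∈) = inj₂ (_ , _ , X∈ , Y∈ , refl)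
    secant-⊕ {X} X∈ (inj₂ (P , P′ , P∈ , P′∈ , refl)) with supp? f (P ⊕ P′)
    ... | yes Y∈ = inj₂ (_ , _ , X∈ , Y∈ , refl)
    ... | no Y∉ = place (another-term (line-secant P∈ P′∈ Y∉ X)
                     (subst (Supp f) (sym (trans (cong (X ⊕_) (·-zeroˡ Y)) (⊕-identityʳ X))) X∈))
      where
      Y = P ⊕ P′
      place : (∃ λ y → y ≢ 0F × Supp f (X ⊕ y · Y)) → Secant (X ⊕ Y)
      place (y , y≢0 , Z∈) = combine (c ≟F 0F)
        where
        b = inv y y≢0
        c = 1F +F (-F b)
        Z = X ⊕ y · Y
        combination : c · X ⊕ b · Z ≡ X ⊕ Y
        combination = trans (cong (c · X ⊕_) (·-distribˡ b X _)) (trans (sym (⊕-assoc _ _ _))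
          (cong₂ _⊕_ (trans (sym (·-distribʳ _ b X)) (trans (cong (_· X) (trans (+-assoc 1F _ b)
            (trans (cong (1F +F_) (-‿inverseˡ b)) (+-identityʳ 1F)))) (·-identity X))) (inv·· y y≢0 Y)))
        combine : Dec (c ≡ 0F) → Secant (X ⊕ Y)
        combine (no c≢0)  = inj₂ (_ , _ , S-scale c≢0 X∈ , S-scale (inv≢0 y y≢0) Z∈ , sym combination)
        combine (yes c≡0) = inj₁ (subst (Supp f)
          (trans (sym (⊕-identityˡ _)) (trans (cong (_⊕ b · Z) (sym (trans (cong (_· X) c≡0) (·-zeroˡ X)))) combination))
          (S-scale (inv≢0 y y≢0) Z∈))

    span⇒secant : ∀ {v} → Span (Supp f) v → Secant v
    span⇒secant zero = let s , s∈ = nonzero in inj₂ (s , ⊖ s , s∈ , S-scale -1≢0 s∈ , sym (⊖-inverseʳ s))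
    span⇒secant (add a {s} {v} s∈ v∈) with a ≟F 0F
    ... | yes refl = subst Secant (sym (trans (cong (_⊕ v) (·-zeroˡ s)) (⊕-identityˡ v))) (span⇒secant v∈)
    ... | no a≢0   = secant-⊕ (S-scale a≢0 s∈) (span⇒secant v∈)

    line-vanishes : ∀ {R} → κ R ≡ 𝟎 → ¬ Supp f R → ∀ x → p ∣ line R x
    line-vanishes κR R∉ with span⇒secant (ker⊆span κR)
    ... | inj₁ R∈ = ⊥-elim (R∉ R∈)
    ... | inj₂ (P , P′ , P∈ , P′∈ , refl) = line-secant P∈ P′∈ R∉

    projection-vanishes-at : ∀ {R} → κ R ≡ 𝟎 → ∀ x → p ∣ projection R x
    projection-vanishes-at {R} κR with supp? f R
    ... | no R∉ = λ x → ∣m∣n⇒∣m+n (line-vanishes κR R∉ x) (∣-⊙ (κ x ≟V 𝟎) λ _ → decidable-stable (p ∣? f R) R∉)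
    ... | yes R∈ = projection-vanishes (supp≢𝟎 R∈) κR meets R R∈ (inj₂ p∣R)
      where
      -- Here the weight drops because `R` itself is lost: its image under the projection is the
      -- origin.
      p∣R : p ∣ projection R R
      p∣R = subst (p ∣_) (trans (sym (projection-shift κR 1F 𝟎)) (cong (projection R) (trans (⊕-identityˡ _) (·-identity R))))
              (projection-origin R)
      meets : ∀ x → ¬ p ∣ projection R x → ∃ λ y → Supp f (x ⊕ y · R)
      meets x p∤ with all? 𝔽 (λ y → p ∣? f (x ⊕ y · R))
      ... | inj₁ found = found
      -- No x + yR is in the support, so neither is `x`, and `x` lies in W as the projection is
      -- nonzero there. Lines through `x` thus have sum 0; the one through `R` has a second support
      -- vector R + yx, a multiple of x + (1/y) R, a contradiction.
      ... | inj₂ none  = let y , y≢0 , u∈ = another-term (line-vanishes κx x∉ R) R∈′ in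
              ⊥-elim (S-scale (inv≢0 y y≢0) u∈ (subst (p ∣_) (cong f (rescale y y≢0)) (none (inv y y≢0))))
        where
        κx : κ x ≡ 𝟎
        κx = decidable-stable (κ x ≟V 𝟎) λ κx≢𝟎 → p∤ (∣m∣n⇒∣m+n (∣-∑ elements none) (∣-⊙ (κ x ≟V 𝟎) (⊥-elim ∘ κx≢𝟎)))
        x∉ : ¬ Supp f x
        x∉ x∈ = x∈ (subst (p ∣_) (cong f (trans (cong (x ⊕_) (·-zeroˡ R)) (⊕-identityʳ x))) (none 0F))
        R∈′ : Supp f (R ⊕ 0F · x)
        R∈′ = subst (Supp f) (sym (trans (cong (R ⊕_) (·-zeroˡ x)) (⊕-identityʳ R))) R∈
        rescale : ∀ y y≢0 → x ⊕ inv y y≢0 · R ≡ inv y y≢0 · (R ⊕ y · x)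
        rescale y y≢0 = trans (⊕-comm x _) (trans (cong (inv y y≢0 · R ⊕_) (sym (inv·· y y≢0 x))) (sym (·-distribˡ _ R _)))

    -- Adding `projection w` over the multiples of `v` gives the sum over ⟨v, w⟩ plus q copies of
    -- `f w`.
    balanced-in-ker : Balanced (Ker κ) 2 f
    balanced-in-ker (v ∷ w ∷ []) (v∈ ∷ w∈ ∷ []) = ∣m+n∣n⇒∣m
      (subst (p ∣_) (∑-+ elements _ _) (∣-∑ elements λ a →
        subst (p ∣_) (cong (line w (𝟎 ⊕ a · v) +_) (⊙-yes (κ (𝟎 ⊕ a · v) ≟V 𝟎) (in-ker a) (f w)))
              (projection-vanishes-at w∈ (𝟎 ⊕ a · v))))
      (p∣∑-const (f w))
      where
      in-ker : ∀ a → κ (𝟎 ⊕ a · v) ≡ 𝟎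
      in-ker a = ker-κ (map-𝟎 κ-linear) (closed-· (ker κ-linear) a v∈)

    -- As the support spans W, some support vector `s` has φ(s) nonzero. Restricting `f` to W ∩ ker
    -- φ loses `s` but keeps `Q`, so minimality fails if the restriction is a codeword.
    no-hyperplane : ∀ {φ} → LinearForm φ → ∀ {Q} → Supp f Q → φ Q ≡ 0F → ∀ {x} → κ x ≡ 𝟎 → φ x ≢ 0F → ⊥
    no-hyperplane {φ} lin {Q} Q∈ φQ {x} κx φx≢0 with Enumeration.search (𝕍 m) (λ s → supp? f s ×-dec ¬? (φ s ≟F 0F))
    ... | no none = φx≢0 (span-⊆ (ker₁ lin) (form-𝟎 lin)
            (λ {s} s∈ → decidable-stable (φ s ≟F 0F) λ φs≢0 → none (s , s∈ , φs≢0)) (ker⊆span κx))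
    ... | yes (s , s∈ , φs≢0) = Q∈ (subst (p ∣_) (⊙-yes (κ⁺ Q ≟V 𝟎) (cong₂ _∷_ φQ (supp⊆ker Q∈)) (f Q))
            (no-smaller restricted smaller Q))
      where
      κ⁺ : V m → V (suc e)
      κ⁺ x = φ x ∷ κ x
      κ⁺-linear = cons-linear φ κ lin κ-linear
      restricted : Codeword (suc (suc k)) (cutᵥ κ⁺ f)
      restricted = record
        { scale = λ a a≢0 v → ⊙-cong (κ⁺ (a · v) ≟V 𝟎) (κ⁺ v ≟V 𝟎)
            (λ eq → trans (sym (inv·· a a≢0 (κ⁺ v))) (trans (cong (inv a a≢0 ·_) (trans (sym (map-· κ⁺-linear a v)) eq)) (·-zeroʳ _)))
            (λ eq → trans (map-· κ⁺-linear a v) (trans (cong (a ·_) eq) (·-zeroʳ a))) (scale code a a≢0 v)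
        ; origin = ∣-⊙ (κ⁺ 𝟎 ≟V 𝟎) (λ _ → origin code)
        -- The e + 1 equations of `κ⁺` leave at least k + 2 - (e + 1) ≥ 2 dimensions inside W, where
        -- sums vanish. This uses `e<k` in full.
        ; balanced = balanced-≤ whole (ℕₚ.≤⇒≤′ (s≤s (subst (_≤ k) (sym (ℕₚ.+-comm e 1)) e<k)))
            (balanced-cutᵥ whole κ⁺-linear (balanced-cong (λ (_ , κ⁺x) → Vecₚ.∷-injectiveʳ κ⁺x) (λ _ → refl) balanced-in-ker)) }
      smaller : size (cutᵥ κ⁺ f) < size f
      smaller = size-< _ f id (λ v v∈ → v , (λ p∣ → v∈ (∣-⊙ (κ⁺ v ≟V 𝟎) λ _ → p∣)) , refl) s s∈
        (inj₂ (∣-⊙ (κ⁺ s ≟V 𝟎) (⊥-elim ∘ φs≢0 ∘ Vecₚ.∷-injectiveˡ)))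

  -- W has at least two coordinates, so some form vanishes at `Q` but not on W: the first coordinate
  -- if it vanishes at `Q`, otherwise the 2 by 2 determinant of the first two coordinates with those
  -- of `Q`.
  codimension-bound : ∀ {m k d e} (f : V m → ℕ) → Codeword (suc (suc k)) f →
    (∀ h → Codeword (suc (suc k)) h → ∃ (Supp h) → size f ≤ size h) → ∃ (Supp f) →
    (s : Split m (suc (suc d)) e) → (∀ {v} → Supp f v → π₂ s v ≡ 𝟎) → (∀ y → Span (Supp f) (ι₁ s y)) →
    k ≤ e
  codimension-bound {m} {k} {d} {e} f code minimal (Q , Q∈) s vanish generated =
    ℕₚ.≮⇒≥ λ e<k → contradict e<k (head y ≟F 0F)
    where
    y = π₁ s Q
    y₀ = head y
    y₁ = head (tail y)
    first : LinearForm (head ∘ π₁ s)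
    first = head-form (π₁-linear s)
    second : LinearForm (head ∘ tail ∘ π₁ s)
    second = head-form (tail-linear (π₁-linear s))
    -- y₀ x₁ − y₁ x₀ in the coordinates x of π₁
    φ : V m → Carrier
    φ v = (y₀ *F head (tail (π₁ s v))) +F ((-F y₁) *F head (π₁ s v))
    form-scaled : ∀ {ψ : V m → Carrier} c → LinearForm ψ → LinearForm (λ v → c *F ψ v)
    form-scaled c lin = record
      { form-⊕ = λ u v → trans (cong (c *F_) (form-⊕ lin u v)) (distribˡ c _ _)
      ; form-· = λ a v → trans (cong (c *F_) (form-· lin a v)) (trans (sym (*-assoc c a _))
          (trans (cong (_*F _) (*F-comm c a)) (*-assoc a c _))) }
    φ-linear : LinearForm φ
    φ-linear = record
      { form-⊕ = λ u v → trans (cong₂ _+F_ (form-⊕ (form-scaled y₀ second) u v) (form-⊕ (form-scaled (-F y₁) first) u v))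
                               (+F-interchange _ _ _ _)
      ; form-· = λ a v → trans (cong₂ _+F_ (form-· (form-scaled y₀ second) a v) (form-· (form-scaled (-F y₁) first) a v))
                               (sym (distribˡ a _ _)) }
    φQ : φ Q ≡ 0F
    φQ = trans (cong₂ _+F_ (*F-comm y₀ y₁) (sym (-‿distribˡ-* y₁ y₀))) (-‿inverseʳ _)
    contradict : e < k → Dec (y₀ ≡ 0F) → ⊥
    contradict e<k (yes y₀≡0) = no-hyperplane first Q∈ y₀≡0 (π₂ι₁ s (1F ∷ 𝟎))
        (subst (_≢ 0F) (sym (cong head (π₁ι₁ s _))) 1≢0)
      where open Minimal f code minimal (π₂ s) (π₂-linear s) vanish
                   (λ {v} π₂v → subst (Span _) (ι₁π₁ s v π₂v) (generated (π₁ s v))) e<k (Q , Q∈)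
    contradict e<k (no y₀≢0) = no-hyperplane φ-linear Q∈ φQ (π₂ι₁ s (0F ∷ 1F ∷ 𝟎))
        (subst (_≢ 0F) (sym (trans (cong (λ z → (y₀ *F head (tail z)) +F ((-F y₁) *F head z)) (π₁ι₁ s (0F ∷ 1F ∷ 𝟎)))
           (trans (cong₂ _+F_ (*-identityʳ y₀) (zeroʳ _)) (+-identityʳ y₀)))) y₀≢0)
      where open Minimal f code minimal (π₂ s) (π₂-linear s) vanish
                   (λ {v} π₂v → subst (Span _) (ι₁π₁ s v π₂v) (generated (π₁ s v))) e<k (Q , Q∈)

-- From lists of normalised points and Boolean tests to vectors and propositions.

if≡⊙ : ∀ b n → (if b then n else 0) ≡ T? b ⊙ n
if≡⊙ false n = refl
if≡⊙ true  n = refl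

⊙-congʳ : {P : Set} (d : Dec P) → ∀ {m n} → (P → m ≡ n) → d ⊙ m ≡ d ⊙ n
⊙-congʳ (yes p) h = h p
⊙-congʳ (no _)  h = refl

∑-filterᵇ : {A : Set} (b : A → Bool) (xs : List A) (g : A → ℕ) → ∑ (filterᵇ b xs) g ≡ ∑ xs (λ x → T? (b x) ⊙ g x)
∑-filterᵇ b []       g = refl
∑-filterᵇ b (x ∷ xs) g with b x
... | true  = cong (g x +_) (∑-filterᵇ b xs g)
... | false = ∑-filterᵇ b xs g

length-filterᵇ : {A : Set} (b : A → Bool) (xs : List A) → length (filterᵇ b xs) ≡ ∑ xs (λ x → T? (b x) ⊙ 1)
length-filterᵇ b xs = trans (sym (trans (∑-const (filterᵇ b xs) 1) (ℕₚ.*-identityʳ _))) (∑-filterᵇ b xs (λ _ → 1))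

module Translation (F : FiniteField) where
  open Vectors F
  open Splitting F
  open Geometry F
  private variable m r : ℕ

  -- Without function extensionality, the empty vector occurring in allVecs has to be read off from it.
  nil : Σ (Vec' 0) λ v → allVecs 0 ≡ v ∷ []
  nil = _ , refl

  emb : V m → Vec' m
  emb []      = proj₁ nil
  emb (x ∷ v) = x ∷ᵥ emb v

  emb-lookup : (v : V m) → ∀ i → emb v i ≡ lookup v i
  emb-lookup (x ∷ v) zero    = refl
  emb-lookup (x ∷ v) (suc i) = emb-lookup v i

  tabulate-emb : (v : V m) → tabulate (emb v) ≡ v
  tabulate-emb v = trans (Vecₚ.tabulate-cong (emb-lookup v)) (Vecₚ.tabulate∘lookup v)

  allVecs-emb : ∀ m → allVecs m ≡ map emb (vectors m)
  allVecs-emb zero    = refl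
  allVecs-emb (suc m) = trans
    (concatMap-cong (λ x → trans (cong (map (x ∷ᵥ_)) (allVecs-emb m))
                                 (trans (sym (map-∘ (vectors m))) (map-∘ (vectors m)))) elements)
    (sym (map-concatMap emb _ elements))

  data Normal : V m → Set where
    leading : {v : V m} → Normal (1F ∷ v)
    skip    : {v : V m} → Normal v → Normal (0F ∷ v)

  normal⇒T : {v : V m} → Normal v → T (isNormalized (emb v))
  normal⇒T leading with 1F ≟F 0F
  ... | yes 1≡0 = ⊥-elim (1≢0 1≡0)
  ... | no _    = subst T (sym (dec-true (1F ≟F 1F) refl)) tt
  normal⇒T (skip nv) with 0F ≟F 0F
  ... | yes _  = normal⇒T nv
  ... | no 0≢0 = ⊥-elim (0≢0 refl)

  T⇒normal : (v : V m) → T (isNormalized (emb v)) → Normal v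
  T⇒normal (x ∷ v) t with x ≟F 0F
  ... | yes refl = skip (T⇒normal v t)
  ... | no _     = subst (λ y → Normal (y ∷ v)) (sym (witness (x ≟F 1F) t)) leading
    where
    witness : {P : Set} (d : Dec P) → T (does d) → P
    witness (yes p) _ = p

  normal? : (v : V m) → Dec (Normal v)
  normal? v = map′ (T⇒normal v) normal⇒T (T? (isNormalized (emb v)))

  pointSum : (V m → ℕ) → ℕ
  pointSum φ = ∑ (vectors _) (λ v → normal? v ⊙ φ v)

  pointSum-cong : {φ ψ : V m → ℕ} → (∀ {v} → Normal v → φ v ≡ ψ v) → pointSum φ ≡ pointSum ψ
  pointSum-cong e = ∑-cong (vectors _) λ v → ⊙-congʳ (normal? v) e

  ∑-points : ∀ n (ψ : Vec' (suc n) → ℕ) → ∑ (points n) ψ ≡ pointSum (ψ ∘ emb)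
  ∑-points n ψ = trans (∑-filterᵇ isNormalized (allVecs (suc n)) ψ)
    (trans (cong (λ us → ∑ us (λ u → T? (isNormalized u) ⊙ ψ u)) (allVecs-emb (suc n)))
    (trans (∑-map emb (vectors (suc n)) (λ u → T? (isNormalized u) ⊙ ψ u))
      (∑-cong (vectors (suc n)) λ v → ⊙-cong (T? (isNormalized (emb v))) (normal? v) (T⇒normal v) normal⇒T refl)))

  point⇒normal : ∀ {n P} → P ∈ points n → Σ (V (suc n)) λ v → Normal v × P ≡ emb v
  point⇒normal {n} {P} P∈ with ∈-filter⁻ (T? ∘ isNormalized) P∈
  ... | P∈all , t with ∈-map⁻ emb (subst (P ∈_) (allVecs-emb (suc n)) P∈all)
  ... | v , _ , refl = v , T⇒normal v t , refl

  normal⇒point : ∀ {n} {v : V (suc n)} → Normal v → emb v ∈ points n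
  normal⇒point {n} {v} nv = ∈-filter⁺ (T? ∘ isNormalized)
    (subst (emb v ∈_) (sym (allVecs-emb (suc n))) (∈-map⁺ emb (Enumeration.covers (𝕍 (suc n)) v))) (normal⇒T nv)

  normalise : (v : V m) → v ≢ 𝟎 → ∃ λ a → a ≢ 0F × Normal (a · v)
  normalise []      v≢𝟎 = ⊥-elim (v≢𝟎 refl)
  normalise (x ∷ v) v≢𝟎 with x ≟F 0F
  ... | no x≢0 = inv x x≢0 , inv≢0 x x≢0 , subst (λ y → Normal (y ∷ inv x x≢0 · v)) (sym (*-inverseˡ x x≢0)) leading
  ... | yes refl = let a , a≢0 , nv = normalise v (v≢𝟎 ∘ cong (0F ∷_)) in
      a , a≢0 , subst (λ y → Normal (y ∷ a · v)) (sym (zeroʳ a)) (skip nv)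

  Homogeneous : (V m → ℕ) → Set
  Homogeneous φ = ∀ a → a ≢ 0F → ∀ v → φ (a · v) ≡ φ v

  -- The points at infinity and the affine points: a normalised vector starts with 0 or with 1.
  pointSum-suc : (φ : V (suc m) → ℕ) → pointSum φ ≡ pointSum (φ ∘ (0F ∷_)) + ∑ (vectors m) (φ ∘ (1F ∷_))
  pointSum-suc {m} φ = trans (∑-vectors-suc m _) (trans (∑-cong elements by-head) (trans (∑-+ elements _ _)
      (cong₂ _+_ (single-≟ 𝔽 0F (λ _ → p₀)) (single-≟ 𝔽 1F (λ _ → s₁)))))
    where
    p₀ = pointSum (φ ∘ (0F ∷_))
    s₁ = ∑ (vectors m) (φ ∘ (1F ∷_))
    unskip : {v : V m} → Normal (0F ∷ v) → Normal v
    unskip nv = unskip′ nv refl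
      where
      unskip′ : ∀ {x} {v : V m} → Normal (x ∷ v) → x ≡ 0F → Normal v
      unskip′ leading   eq = ⊥-elim (1≢0 eq)
      unskip′ (skip nv) eq = nv
    abnormal : ∀ {x} {v : V m} → x ≢ 0F → x ≢ 1F → ¬ Normal (x ∷ v)
    abnormal x≢0 x≢1 leading  = x≢1 refl
    abnormal x≢0 x≢1 (skip _) = x≢0 refl
    by-head : ∀ x → ∑ (vectors m) (λ v → normal? (x ∷ v) ⊙ φ (x ∷ v)) ≡ (x ≟F 0F) ⊙ p₀ + (x ≟F 1F) ⊙ s₁
    by-head x = cases (x ≟F 0F) (x ≟F 1F)
      where
      cases : (d₀ : Dec (x ≡ 0F)) (d₁ : Dec (x ≡ 1F)) →
              ∑ (vectors m) (λ v → normal? (x ∷ v) ⊙ φ (x ∷ v)) ≡ d₀ ⊙ p₀ + d₁ ⊙ s₁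
      cases (yes refl) (yes 0≡1)  = ⊥-elim (0≢1 0≡1)
      cases (yes refl) (no _)     = trans (∑-cong (vectors m) λ v → ⊙-cong (normal? (0F ∷ v)) (normal? v) unskip skip refl)
                                          (sym (ℕₚ.+-identityʳ p₀))
      cases (no _)     (yes refl) = ∑-cong (vectors m) λ v → ⊙-yes (normal? (1F ∷ v)) leading _
      cases (no x≢0)   (no x≢1)   = ∑-zero (vectors m) λ v → ⊙-no (normal? (x ∷ v)) (abnormal x≢0 x≢1) _

  -- Every point is represented by q − 1 vectors.
  ∑-homogeneous : {φ : V m → ℕ} → Homogeneous φ → ∑ (vectors m) φ + pointSum φ ≡ φ 𝟎 + order * pointSum φ
  ∑-homogeneous {zero}  {φ} hom = cong (φ [] + 0 +_) (sym (ℕₚ.*-zeroʳ order)) ⟨ trans ⟩ cong (_+ order * 0) (ℕₚ.+-identityʳ _)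
    where open import Function.Base using (_⟨_⟩_)
  ∑-homogeneous {suc m} {φ} hom = begin
    ∑ (vectors (suc m)) φ + pointSum φ    ≡⟨ cong₂ _+_ (∑-vectors-suc m φ) (pointSum-suc φ) ⟩
    ∑ elements slice + (p₀ + s₁)          ≡⟨ cong (∑ elements slice +_) (ℕₚ.+-comm p₀ s₁) ⟩
    ∑ elements slice + (s₁ + p₀)          ≡⟨ ℕₚ.+-assoc _ s₁ p₀ ⟨
    ∑ elements slice + s₁ + p₀            ≡⟨ cong (_+ p₀) slices ⟩
    s₀ + order * s₁ + p₀                  ≡⟨ ℕₚ.+-assoc s₀ _ p₀ ⟩
    s₀ + (order * s₁ + p₀)                ≡⟨ cong (s₀ +_) (ℕₚ.+-comm _ p₀) ⟩
    s₀ + (p₀ + order * s₁)                ≡⟨ ℕₚ.+-assoc s₀ p₀ _ ⟨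
    s₀ + p₀ + order * s₁                  ≡⟨ cong (_+ order * s₁) (∑-homogeneous hom₀) ⟩
    φ 𝟎 + order * p₀ + order * s₁         ≡⟨ ℕₚ.+-assoc (φ 𝟎) _ _ ⟩
    φ 𝟎 + (order * p₀ + order * s₁)       ≡⟨ cong (φ 𝟎 +_) (ℕₚ.*-distribˡ-+ order p₀ s₁) ⟨
    φ 𝟎 + order * (p₀ + s₁)               ≡⟨ cong (λ n → φ 𝟎 + order * n) (pointSum-suc φ) ⟨
    φ 𝟎 + order * pointSum φ              ∎
    where
    open ≡-Reasoning
    p₀ = pointSum (φ ∘ (0F ∷_))
    slice : Carrier → ℕ
    slice x = ∑ (vectors m) (λ v → φ (x ∷ v))
    s₀ = slice 0F
    s₁ = slice 1F
    hom₀ : Homogeneous (φ ∘ (0F ∷_))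
    hom₀ a a≢0 v = trans (cong (λ y → φ (y ∷ a · v)) (sym (zeroʳ a))) (hom a a≢0 (0F ∷ v))
    unit-slice : ∀ x → x ≢ 0F → slice x ≡ s₁
    unit-slice x x≢0 = trans
      (sym (∑-reindex (𝕍 m) (𝕍 m) (x ·_) (inv x x≢0 ·_) (inv·· x x≢0) (·inv· x x≢0) (λ v → φ (x ∷ v))))
      (∑-cong (vectors m) λ v → trans (cong (λ y → φ (y ∷ x · v)) (sym (*-identityʳ x))) (hom x x≢0 (1F ∷ v)))
    by-head : ∀ x → slice x + (x ≟F 0F) ⊙ s₁ ≡ (x ≟F 0F) ⊙ s₀ + s₁
    by-head x with x ≟F 0F
    ... | yes refl = refl
    ... | no x≢0   = trans (ℕₚ.+-identityʳ _) (unit-slice x x≢0)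
    slices : ∑ elements slice + s₁ ≡ s₀ + order * s₁
    slices = begin
      ∑ elements slice + s₁                                   ≡⟨ cong (∑ elements slice +_) (single-≟ 𝔽 0F (λ _ → s₁)) ⟨
      ∑ elements slice + ∑ elements (λ x → (x ≟F 0F) ⊙ s₁)    ≡⟨ ∑-+ elements _ _ ⟨
      ∑ elements (λ x → slice x + (x ≟F 0F) ⊙ s₁)             ≡⟨ ∑-cong elements by-head ⟩
      ∑ elements (λ x → (x ≟F 0F) ⊙ s₀ + s₁)                  ≡⟨ ∑-+ elements _ _ ⟩
      ∑ elements (λ x → (x ≟F 0F) ⊙ s₀) + ∑ elements (λ _ → s₁)
        ≡⟨ cong₂ _+_ (single-≟ 𝔽 0F (λ _ → s₀)) (∑-const elements s₁) ⟩
      s₀ + order * s₁ ∎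

  -- Divides by the first nonzero coordinate before reading `c`. The default 0 at the zero vector
  -- provides the `origin` condition.
  extend : (V m → ℕ) → V m → ℕ
  extend c []      = 0
  extend c (x ∷ v) with x ≟F 0F
  ... | yes _  = extend (c ∘ (0F ∷_)) v
  ... | no x≢0 = c (1F ∷ inv x x≢0 · v)

  extend-homogeneous : (c : V m → ℕ) → Homogeneous (extend c)
  extend-homogeneous c a a≢0 []      = refl
  extend-homogeneous c a a≢0 (x ∷ v) with x ≟F 0F | (a *F x) ≟F 0F
  ... | yes _    | yes _   = extend-homogeneous (c ∘ (0F ∷_)) a a≢0 v
  ... | yes refl | no ax≢0 = ⊥-elim (ax≢0 (zeroʳ a))
  ... | no x≢0   | yes ax≡0 = ⊥-elim (x≢0 (trans (sym (*-cancel-inv a a≢0 x))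
                                (trans (cong (_*F inv a a≢0) (trans (*F-comm x a) ax≡0)) (zeroˡ _))))
  ... | no x≢0   | no ax≢0 = cong (λ w → c (1F ∷ w))
          (trans (cong (inv (a *F x) ax≢0 ·_) (trans (cong (a ·_) (sym (·inv· x x≢0 v))) (sym (·-assoc a x _)))) (inv·· _ ax≢0 _))

  extend-𝟎 : (c : V m → ℕ) → extend c 𝟎 ≡ 0
  extend-𝟎 {zero}  c = refl
  extend-𝟎 {suc m} c with 0F ≟F 0F
  ... | yes _  = extend-𝟎 (c ∘ (0F ∷_))
  ... | no 0≢0 = ⊥-elim (0≢0 refl)

  extend-normal : (c : V m → ℕ) → ∀ {v} → Normal v → extend c v ≡ c v
  extend-normal c leading with 1F ≟F 0F
  ... | yes 1≡0 = ⊥-elim (1≢0 1≡0)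
  ... | no 1≢0′ = cong (λ w → c (1F ∷ w)) (trans (cong (inv 1F 1≢0′ ·_) (sym (·-identity _))) (inv·· 1F 1≢0′ _))
  extend-normal c (skip nv) with 0F ≟F 0F
  ... | yes _  = extend-normal (c ∘ (0F ∷_)) nv
  ... | no 0≢0 = ⊥-elim (0≢0 refl)

  comb : V r → Vec (V m) r → V m
  comb []       []       = 𝟎
  comb (a ∷ as) (v ∷ vs) = a · v ⊕ comb as vs

  comb-⊕ : ∀ (as bs : V r) (vs : Vec (V m) r) → comb (as ⊕ bs) vs ≡ comb as vs ⊕ comb bs vs
  comb-⊕ []       []       []       = sym (⊕-identityˡ 𝟎)
  comb-⊕ (a ∷ as) (b ∷ bs) (v ∷ vs) = trans (cong₂ _⊕_ (·-distribʳ a b v) (comb-⊕ as bs vs)) (⊕-interchange _ _ _ _)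

  comb-· : ∀ c (as : V r) (vs : Vec (V m) r) → comb (c · as) vs ≡ c · comb as vs
  comb-· c []       []       = sym (·-zeroʳ c)
  comb-· c (a ∷ as) (v ∷ vs) = trans (cong₂ _⊕_ (·-assoc c a v) (comb-· c as vs)) (sym (·-distribˡ c _ _))

  linear-comb : {f : V r → V m} → Linear f → Σ (Vec (V m) r) λ vs → ∀ as → comb as vs ≡ f as
  linear-comb {zero}  lin = [] , λ { [] → sym (map-𝟎 lin) }
  linear-comb {suc r} {f = f} lin =
    let vs , eq = linear-comb (∘-linear lin (cons-linear _ _ zero-form id-linear)) in
    f (1F ∷ 𝟎) ∷ vs , λ { (a ∷ as) → trans (cong₂ _⊕_ (sym (map-· lin a _)) (eq as))
      (trans (sym (map-⊕ lin _ _)) (cong f (cong₂ _∷_ (trans (+-identityʳ _) (*-identityʳ a))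
        (trans (cong (_⊕ as) (·-zeroʳ a)) (⊕-identityˡ as))))) }

  Independent : Vec (V m) r → Set
  Independent vs = ∀ as → comb as vs ≡ 𝟎 → as ≡ 𝟎

  ⊖-unique : {u v : V m} → u ⊕ ⊖ v ≡ 𝟎 → u ≡ v
  ⊖-unique {u = u} {v} eq = trans (sym (⊕-identityʳ u)) (trans (cong (u ⊕_) (trans (sym (⊖-inverseʳ v)) (⊕-comm v _)))
    (trans (sym (⊕-assoc u _ v)) (trans (cong (_⊕ v) eq) (⊕-identityˡ v))))

  independent-injective : {vs : Vec (V m) r} → Independent vs → ∀ as bs → comb as vs ≡ comb bs vs → as ≡ bs
  independent-injective {vs = vs} ind as bs eq = ⊖-unique (ind (as ⊕ ⊖ bs)
    (trans (comb-⊕ as _ vs) (trans (cong₂ _⊕_ eq (comb-· _ bs vs)) (⊖-inverseʳ _))))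

  Spanned : Vec (V m) r → V m → Set
  Spanned vs v = ∃ λ as → comb as vs ≡ v

  spanned? : (vs : Vec (V m) r) → ∀ v → Dec (Spanned vs v)
  spanned? {m} {r} vs v = searchV r λ as → comb as vs ≟V v

  spanSum-comb : (vs : Vec (V m) r) (f : V m → ℕ) → ∀ x → spanSum vs f x ≡ ∑ (vectors r) (λ as → f (x ⊕ comb as vs))
  spanSum-comb []       f x = trans (cong f (sym (⊕-identityʳ x))) (sym (ℕₚ.+-identityʳ _))
  spanSum-comb (v ∷ vs) f x = trans
    (∑-cong elements λ y → trans (spanSum-comb vs f (x ⊕ y · v)) (∑-cong (vectors _) λ as → cong f (⊕-assoc x (y · v) (comb as vs))))
    (sym (∑-vectors-suc _ _))

  -- Distinct coefficient vectors give distinct combinations, so each vector of the span is counted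
  -- once.
  spanSum-independent : {vs : Vec (V m) r} → Independent vs → ∀ f →
                        spanSum vs f 𝟎 ≡ ∑ (vectors m) (λ v → spanned? vs v ⊙ f v)
  spanSum-independent {m} {r} {vs} ind f = trans (spanSum-comb vs f 𝟎) (trans
      (∑-cong (vectors r) λ as → cong f (⊕-identityˡ _))
      (trans (∑-fibre (𝕍 m) (vectors r) (λ as → comb as vs) _) (∑-cong (vectors m) fibre)))
    where
    fibre : ∀ v → ∑ (vectors r) (λ as → (v ≟V comb as vs) ⊙ f (comb as vs)) ≡ spanned? vs v ⊙ f v
    fibre v with spanned? vs v
    ... | no ∉ = ∑-zero (vectors r) λ as → ⊙-no (v ≟V comb as vs) (λ eq → ∉ (as , sym eq)) _
    ... | yes (as , refl) = single-Dec (𝕍 r) (λ bs → v ≟V comb bs vs) refl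
                              (λ bs eq → independent-injective ind bs as (sym eq)) _

  matrix : (Fin r → Vec' m) → Vec (V m) r
  matrix vs = tabulate (tabulate ∘ vs)

  tabulate-⊕ : (u v : Vec' m) → tabulate u ⊕ tabulate v ≡ tabulate (λ j → u j +F v j)
  tabulate-⊕ {zero}  u v = refl
  tabulate-⊕ {suc m} u v = cong (u zero +F v zero ∷_) (tabulate-⊕ (u ∘ suc) (v ∘ suc))

  tabulate-· : ∀ a (v : Vec' m) → a · tabulate v ≡ tabulate (λ j → a *F v j)
  tabulate-· {zero}  a v = refl
  tabulate-· {suc m} a v = cong (a *F v zero ∷_) (tabulate-· a (v ∘ suc))

  tabulate-𝟎 : tabulate {n = m} (λ _ → 0F) ≡ 𝟎
  tabulate-𝟎 {zero}  = refl
  tabulate-𝟎 {suc m} = cong (0F ∷_) tabulate-𝟎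

  comb-matrix : (a : Fin r → Carrier) (vs : Fin r → Vec' m) → comb (tabulate a) (matrix vs) ≡ tabulate (lincomb a vs)
  comb-matrix {zero}  a vs = sym tabulate-𝟎
  comb-matrix {suc r} a vs = trans (cong₂ _⊕_ (tabulate-· (a zero) (vs zero)) (comb-matrix (a ∘ suc) (vs ∘ suc))) (tabulate-⊕ _ _)

  tabulate-injective : {u v : Vec' m} → tabulate u ≡ tabulate v → ∀ i → u i ≡ v i
  tabulate-injective {u = u} {v} eq i = trans (sym (Vecₚ.lookup∘tabulate u i))
    (trans (cong (λ w → lookup w i) eq) (Vecₚ.lookup∘tabulate v i))

  linIndep⇒independent : (vs : Fin r → Vec' m) → LinIndep vs → Independent (matrix vs)
  linIndep⇒independent vs lin as eq = trans (sym (Vecₚ.tabulate∘lookup as))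
    (trans (Vecₚ.tabulate-cong (lin (lookup as) (tabulate-injective (trans (sym (comb-matrix (lookup as) vs))
      (trans (cong (λ bs → comb bs (matrix vs)) (Vecₚ.tabulate∘lookup as)) (trans eq (sym tabulate-𝟎))))))) tabulate-𝟎)

  independent⇒linIndep : (vs : Fin r → Vec' m) → Independent (matrix vs) → LinIndep vs
  independent⇒linIndep vs ind a eq = tabulate-injective (trans (ind (tabulate a)
    (trans (comb-matrix a vs) (trans (Vecₚ.tabulate-cong eq) tabulate-𝟎))) (sym tabulate-𝟎))

  eqVec⇒≡ : (u w : Vec' m) → T (eqVec u w) → tabulate u ≡ tabulate w
  eqVec⇒≡ {zero}  u w t = refl
  eqVec⇒≡ {suc m} u w t with u zero ≟F w zero
  ... | yes eq = cong₂ _∷_ eq (eqVec⇒≡ (u ∘ suc) (w ∘ suc) t)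
  ... | no _   = ⊥-elim t

  ≡⇒eqVec : (u w : Vec' m) → tabulate u ≡ tabulate w → T (eqVec u w)
  ≡⇒eqVec {zero}  u w eq = tt
  ≡⇒eqVec {suc m} u w eq with u zero ≟F w zero
  ... | yes _ = ≡⇒eqVec (u ∘ suc) (w ∘ suc) (Vecₚ.∷-injectiveʳ eq)
  ... | no u≢w = ⊥-elim (u≢w (Vecₚ.∷-injectiveˡ eq))

  inSpan⇒spanned : (vs : Fin r → Vec' m) (v : V m) → T (inSpan vs (emb v)) → Spanned (matrix vs) v
  inSpan⇒spanned {r} vs v t with find (any⁻ _ (allVecs r) t)
  ... | a , _ , eq = tabulate a , trans (comb-matrix a vs) (trans (sym (eqVec⇒≡ (emb v) _ eq)) (tabulate-emb v))

  spanned⇒inSpan : (vs : Fin r → Vec' m) (v : V m) → Spanned (matrix vs) v → T (inSpan vs (emb v))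
  spanned⇒inSpan {r} vs v (as , eq) = any⁺ _ (lose
    (subst (emb as ∈_) (sym (allVecs-emb r)) (∈-map⁺ emb (Enumeration.covers (𝕍 r) as)))
    (≡⇒eqVec (emb v) _ (trans (tabulate-emb v) (trans (sym eq)
      (trans (cong (λ bs → comb bs (matrix vs)) (sym (tabulate-emb as))) (comb-matrix (emb as) vs))))))

-- Words of the dual code versus codewords on vectors, and the conclusion.

module Correspondence (F : FiniteField) {p : ℕ} (p∣q : p ∣ FiniteField.order F) .{{_ : NonZero p}} where
  open Vectors F
  open Sums p∣q
  open Splitting F
  open Codewords F p∣q
  open Codeword
  open Translation F
  open Geometry F
  private variable m n r k : ℕ

  -- Mod p, `∑-homogeneous` reads: the sum over vectors is minus the sum over points.
  ∑⇒pointSum : {φ : V m → ℕ} → Homogeneous φ → p ∣ φ 𝟎 → p ∣ ∑ (vectors m) φ → p ∣ pointSum φ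
  ∑⇒pointSum {φ = φ} hom p∣φ𝟎 p∣∑ = ∣m+n∣m⇒∣n
    (subst (p ∣_) (sym (∑-homogeneous hom)) (∣m∣n⇒∣m+n p∣φ𝟎 (∣m⇒∣m*n (pointSum φ) p∣q))) p∣∑

  pointSum⇒∑ : {φ : V m → ℕ} → Homogeneous φ → p ∣ φ 𝟎 → p ∣ pointSum φ → p ∣ ∑ (vectors m) φ
  pointSum⇒∑ {φ = φ} hom p∣φ𝟎 p∣points = ∣m+n∣n⇒∣m
    (subst (p ∣_) (sym (∑-homogeneous hom)) (∣m∣n⇒∣m+n p∣φ𝟎 (∣m⇒∣m*n (pointSum φ) p∣q))) p∣points

  spanned-homogeneous : (vs : Vec (V m) r) {f : V m → ℕ} → Homogeneous f → Homogeneous (λ v → spanned? vs v ⊙ f v)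
  spanned-homogeneous vs hom a a≢0 v = ⊙-cong (spanned? vs (a · v)) (spanned? vs v)
    (λ (as , eq) → inv a a≢0 · as , trans (comb-· _ as vs) (trans (cong (inv a a≢0 ·_) eq) (inv·· a a≢0 v)))
    (λ (as , eq) → a · as , trans (comb-· a as vs) (cong (a ·_) eq))
    (hom a a≢0 v)

  supp-homogeneous : {f : V m → ℕ} → Homogeneous f → Homogeneous (λ v → supp? f v ⊙ 1)
  supp-homogeneous {f = f} hom a a≢0 v = cong (λ n → ¬? (p ∣? n) ⊙ 1) (hom a a≢0 v)

  order-suc : ∃ λ q′ → order ≡ suc q′
  order-suc = nonempty (complete 0F)
    where
    nonempty : ∀ {x} {xs : List Carrier} → x ∈ xs → ∃ λ l → length xs ≡ suc l
    nonempty {xs = _ ∷ xs} _ = length xs , refl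

  -- The factor q′ = q - 1 is chosen before `f`, so that the sizes of two words can be compared
  -- through their weights.
  size-points : ∃ λ q′ → ∀ {m} {f : V m → ℕ} → Homogeneous f → p ∣ f 𝟎 → size f ≡ q′ * pointSum (λ v → supp? f v ⊙ 1)
  size-points = let q′ , q≡ = order-suc in q′ , λ {m} {f} hom p∣f𝟎 →
    let P = pointSum (λ v → supp? f v ⊙ 1) in
    ℕₚ.+-cancelʳ-≡ P _ _ (trans (∑-homogeneous (supp-homogeneous hom))
      (trans (cong (_+ order * P) (⊙-no (supp? f 𝟎) (λ ∤ → ∤ p∣f𝟎) 1))
        (trans (cong (_* P) q≡) (ℕₚ.+-comm P _))))

  Represents : Word p n → (V (suc n) → ℕ) → Set
  Represents c f = ∀ {v} → Normal v → toℕ (c (emb v)) ≡ f v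

  incProduct-points : {c : Word p n} {f : V (suc n) → ℕ} → Represents c f → (S : ProjSubspace n k) →
                      incProduct c S ≡ pointSum (λ v → spanned? (matrix (proj₁ S)) v ⊙ f v)
  incProduct-points {n} {c = c} {f} rep (vs , _) = trans (∑-points n _) (pointSum-cong λ {v} nv →
    trans (if≡⊙ (inSpan vs (emb v)) _)
      (⊙-cong (T? (inSpan vs (emb v))) (spanned? (matrix vs) v) (inSpan⇒spanned vs v) (spanned⇒inSpan vs v) (rep nv)))

  nonzero⇒supp : ∀ {a} (x : Fin p) → toℕ x ≡ a → a ≢ 0 → ¬ p ∣ a
  nonzero⇒supp {zero}  x eq a≢0 _   = a≢0 refl
  nonzero⇒supp {suc a} x eq _   p∣a = ℕₚ.<⇒≱ (subst (_< p) eq (toℕ<n x)) (∣⇒≤ p∣a)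

  T-nonzeroAt : (x : Fin p) → T (nonzeroAt x) → toℕ x ≢ 0
  T-nonzeroAt x t eq with toℕ x
  T-nonzeroAt x () refl | _

  nonzeroAt-T : (x : Fin p) → toℕ x ≢ 0 → T (nonzeroAt x)
  nonzeroAt-T x ≢0 with toℕ x
  ... | zero  = ≢0 refl
  ... | suc _ = tt

  weight-points : (c : Word p n) {f : V (suc n) → ℕ} → Represents c f → weight c ≡ pointSum (λ v → supp? f v ⊙ 1)
  weight-points {n} c {f} rep = trans (length-filterᵇ _ (points n)) (trans (∑-points n _)
    (pointSum-cong λ {v} nv → ⊙-cong (T? (nonzeroAt (c (emb v)))) (supp? f v)
      (λ t → nonzero⇒supp (c (emb v)) (rep nv) (subst (_≢ 0) (rep nv) (T-nonzeroAt _ t)))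
      (λ v∈ → nonzeroAt-T _ λ eq → v∈ (subst (p ∣_) (trans (sym eq) (rep nv)) (_ ∣0)))
      refl))

  spanSum-invariant : (vs : Vec (V m) r) (f : V m → ℕ) → ∀ as x → spanSum vs f (x ⊕ comb as vs) ≡ spanSum vs f x
  spanSum-invariant {r = r} vs f as x = begin
    spanSum vs f (x ⊕ comb as vs)
      ≡⟨ spanSum-comb vs f _ ⟩
    ∑ (vectors r) (λ bs → f ((x ⊕ comb as vs) ⊕ comb bs vs))
      ≡⟨ ∑-cong (vectors r) (λ bs → cong f (trans (⊕-assoc x _ _) (cong (x ⊕_) (sym (comb-⊕ as bs vs))))) ⟩
    ∑ (vectors r) (λ bs → f (x ⊕ comb (as ⊕ bs) vs))
      ≡⟨ ∑-reindex (𝕍 r) (𝕍 r) (as ⊕_) (⊖ as ⊕_)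
           (λ bs → trans (sym (⊕-assoc _ as bs)) (trans (cong (_⊕ bs) (trans (⊕-comm _ as) (⊖-inverseʳ as))) (⊕-identityˡ bs)))
           (λ bs → trans (sym (⊕-assoc as _ bs)) (trans (cong (_⊕ bs) (⊖-inverseʳ as)) (⊕-identityˡ bs)))
           (λ bs → f (x ⊕ comb bs vs)) ⟩
    ∑ (vectors r) (λ bs → f (x ⊕ comb bs vs))
      ≡⟨ spanSum-comb vs f x ⟨
    spanSum vs f x ∎
    where open ≡-Reasoning

  -- If `v` lies in ⟨vs⟩, shifting by y·v does not change the sum over ⟨vs⟩, so q equal summands
  -- arise. This closes the gap between `Balanced`, which admits all tuples, and `InDual`, which
  -- sees only independent ones.
  independent-or-vanishing : (vs : Vec (V m) r) → Independent vs ⊎ (∀ f x → p ∣ spanSum vs f x)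
  independent-or-vanishing [] = inj₁ λ { [] _ → refl }
  independent-or-vanishing (v ∷ vs) with independent-or-vanishing vs
  ... | inj₂ vanish = inj₂ λ f x → ∣-∑ elements λ y → vanish f (x ⊕ y · v)
  ... | inj₁ ind with spanned? vs v
  ... | yes (as , refl) = inj₂ λ f x → subst (p ∣_)
          (∑-cong elements λ y → sym (trans (cong (λ w → spanSum vs f (x ⊕ w)) (sym (comb-· y as vs)))
                                            (spanSum-invariant vs f (y · as) x)))
          (p∣∑-const (spanSum vs f x))
  ... | no v∉ = inj₁ extended
    where
    extended : Independent (v ∷ vs)
    extended (b ∷ bs) eq with b ≟F 0F
    ... | yes refl = cong (0F ∷_) (ind bs (trans (sym (⊕-identityˡ _)) (trans (cong (_⊕ comb bs vs) (sym (·-zeroˡ v))) eq)))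
    ... | no b≢0 = ⊥-elim (v∉ (inv b b≢0 · ⊖ bs , trans (comb-· (inv b b≢0) (⊖ bs) vs)
            (trans (cong (inv b b≢0 ·_) (trans (comb-· (-F 1F) bs vs) (sym bv))) (inv·· b b≢0 v))))
      where
      w = comb bs vs
      bv : b · v ≡ ⊖ w
      bv = trans (sym (⊕-identityʳ _)) (trans (cong (b · v ⊕_) (sym (⊖-inverseʳ w)))
             (trans (sym (⊕-assoc _ w _)) (trans (cong (_⊕ ⊖ w) eq) (⊕-identityˡ _))))

  matrix-lookup : (vs : Vec (V m) r) → matrix (λ i → lookup (lookup vs i)) ≡ vs
  matrix-lookup vs = trans (Vecₚ.tabulate-cong λ i → Vecₚ.tabulate∘lookup (lookup vs i)) (Vecₚ.tabulate∘lookup vs)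

  subspace : (vs : Vec (V (suc n)) (suc k)) → Independent vs → ProjSubspace n k
  subspace vs ind = rows , independent⇒linIndep rows (subst Independent (sym (matrix-lookup vs)) ind)
    where rows = λ i → lookup (lookup vs i)

  dual⇒codeword : {c : Word p n} {f : V (suc n) → ℕ} → Represents c f → Homogeneous f → p ∣ f 𝟎 →
                  InDual p n k c → Codeword (suc k) f
  dual⇒codeword {n} {k} {c} {f} rep hom p∣f𝟎 dual = record { scale = hom ; origin = p∣f𝟎 ; balanced = λ vs _ → bal vs }
    where
    bal : (vs : Vec (V (suc n)) (suc k)) → p ∣ spanSum vs f 𝟎
    bal vs with independent-or-vanishing vs
    ... | inj₂ vanish = vanish f 𝟎
    ... | inj₁ ind = subst (p ∣_) (sym (spanSum-independent ind f))
            (pointSum⇒∑ (spanned-homogeneous vs hom) (∣-⊙ (spanned? vs 𝟎) λ _ → p∣f𝟎)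
              (subst (λ us → p ∣ pointSum (λ v → spanned? us v ⊙ f v)) (matrix-lookup vs)
                (subst (p ∣_) (incProduct-points rep (subspace vs ind)) (dual (subspace vs ind)))))

  codeword⇒dual : {c : Word p n} {f : V (suc n) → ℕ} → Represents c f → Codeword (suc k) f → InDual p n k c
  codeword⇒dual {f = f} rep code S@(vs , lin) = subst (p ∣_) (sym (incProduct-points rep S))
    (∑⇒pointSum (spanned-homogeneous (matrix vs) (scale code)) (∣-⊙ (spanned? (matrix vs) 𝟎) λ _ → origin code)
      (subst (p ∣_) (spanSum-independent (linIndep⇒independent vs lin) f)
        (balanced code (matrix vs) (VAll.universal (λ _ → tt) (matrix vs)))))

  -- The competitors built above have arbitrary natural values, whereas minimality of `c` concerns
  -- words with values in `Fin p`.
  reduce : (V m → ℕ) → V m → ℕ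
  reduce h v = h v % p

  p∣reduce : (h : V m → ℕ) → ∀ {v} → p ∣ h v → p ∣ reduce h v
  p∣reduce h p∣ = %-presˡ-∣ p∣ ∣-refl

  p∣unreduce : (h : V m → ℕ) → ∀ {v} → p ∣ reduce h v → p ∣ h v
  p∣unreduce h {v} p∣ = subst (p ∣_) (sym (m≡m%n+[m/n]*n (h v) p)) (∣m∣n⇒∣m+n p∣ (n∣m*n (h v / p)))

  reduce-codeword : {h : V m → ℕ} → Codeword k h → Codeword k (reduce h)
  reduce-codeword {h = h} code = record
    { scale = λ a a≢0 v → cong (_% p) (scale code a a≢0 v)
    ; origin = p∣reduce h (origin code)
    ; balanced = λ vs vs∈ → ∣m+n∣n⇒∣m
        (subst (p ∣_) (trans (spanSum-cong vs (λ v → m≡m%n+[m/n]*n (h v) p) 𝟎) (spanSum-+ vs (reduce h) _ 𝟎)) (balanced code vs vs∈))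
        (spanSum-∣ vs (λ v → n∣m*n (h v / p)) 𝟎) }

  wordOf : (V (suc n) → ℕ) → Word p n
  wordOf h P = fromℕ< (m%n<n (h (tabulate P)) p)

  wordOf-represents : (h : V (suc n) → ℕ) → Represents (wordOf h) (reduce h)
  wordOf-represents h {v} _ = trans (toℕ-fromℕ< _) (cong (reduce h) (tabulate-emb v))

  wordOf-nonzero : {h : V (suc n) → ℕ} → Codeword k h → ∃ (Supp h) → NonzeroWord (wordOf h)
  wordOf-nonzero {h = h} code (v , v∈) =
    let a , a≢0 , nv = normalise v (λ { refl → v∈ (origin code) }) in
    emb (a · v) , normal⇒point nv , λ eq → v∈ (subst (p ∣_) (scale code a a≢0 v)
      (p∣unreduce h (subst (p ∣_) (trans (sym eq) (wordOf-represents h nv)) (_ ∣0))))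

  size-reduce : (h : V m → ℕ) → size (reduce h) ≡ size h
  size-reduce h = ∑-cong (vectors _) λ v → ⊙-cong (supp? (reduce h) v) (supp? h v)
    (_∘ p∣reduce h) (_∘ p∣unreduce h) refl

  minimal-size : {c : Word p n} {f : V (suc n) → ℕ} → Represents c f → Codeword (suc k) f → MinWeightDual p n k c →
                 ∀ h → Codeword (suc k) h → ∃ (Supp h) → size f ≤ size h
  minimal-size {c = c} {f} rep code (_ , _ , minimal) h h-code nonzero = begin
    size f                                            ≡⟨ size≡ (scale code) (origin code) ⟩
    q′ * pointSum (λ v → supp? f v ⊙ 1)               ≡⟨ cong (q′ *_) (weight-points c rep) ⟨
    q′ * weight c                                     ≤⟨ ℕₚ.*-monoʳ-≤ q′ (minimal (wordOf h)
                                                           (codeword⇒dual (wordOf-represents h) reduced) (wordOf-nonzero h-code nonzero)) ⟩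
    q′ * weight (wordOf h)                            ≡⟨ cong (q′ *_) (weight-points (wordOf h) (wordOf-represents h)) ⟩
    q′ * pointSum (λ v → supp? (reduce h) v ⊙ 1)      ≡⟨ size≡ (scale reduced) (origin reduced) ⟨
    size (reduce h)                                   ≡⟨ size-reduce h ⟩
    size h                                            ∎
    where
    open ℕₚ.≤-Reasoning
    reduced = reduce-codeword h-code
    q′ = proj₁ size-points
    size≡ = proj₂ size-points

  -- The images of the unit vectors under `ι₁` form a basis of the first summand, independent
  -- because `π₁` inverts `ι₁`.
  image-contains : {s : Split (suc n) (suc r) k} {c : Word p n} {f : V (suc n) → ℕ} → Represents c f →
                   (∀ {v} → Supp f v → π₂ s v ≡ 𝟎) →
                   Σ (ProjSubspace n r) λ S → ∀ P → InSupp c P → inSpan (proj₁ S) P ≡ true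
  image-contains {s = s} {c} {f} rep vanish = subspace vs ind , contained
    where
    vs = proj₁ (linear-comb (ι₁-linear s))
    comb≡ι₁ = proj₂ (linear-comb (ι₁-linear s))
    ind : Independent vs
    ind as eq = trans (sym (π₁ι₁ s as)) (trans (cong (π₁ s) (trans (sym (comb≡ι₁ as)) eq)) (map-𝟎 (π₁-linear s)))
    contained : ∀ P → InSupp c P → inSpan (proj₁ (subspace vs ind)) P ≡ true
    contained P (P∈ , c≢0) with point⇒normal P∈
    ... | v , nv , refl = Equivalence.to T-≡ (spanned⇒inSpan (λ i → lookup (lookup vs i)) v
            (subst (λ us → Spanned us v) (sym (matrix-lookup vs))
              (π₁ s v , trans (comb≡ι₁ _) (ι₁π₁ s v (vanish (nonzero⇒supp (c (emb v)) (rep nv) (subst (_≢ 0) (rep nv) c≢0)))))))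

  support-in-subspace : ∀ n k → suc k ≤ n → (c : Word p n) → MinWeightDual p n (suc k) c →
    Σ (ProjSubspace n ((n ∸ suc k) + 1)) λ S → ∀ P → InSupp c P → inSpan (proj₁ S) P ≡ true
  support-in-subspace n k k<n c min@(dual , (P , P∈ , c≢0) , _) = by-dimension (d A ≤? bound)
    where
    open Adapted
    f : V (suc n) → ℕ
    f = extend (toℕ ∘ c ∘ emb)
    represents : Represents c f
    represents nv = sym (extend-normal _ nv)
    code : Codeword (suc (suc k)) f
    code = dual⇒codeword represents (extend-homogeneous _) (subst (p ∣_) (sym (extend-𝟎 _)) (_ ∣0)) dual
    nonzero : ∃ (Supp f)
    nonzero with point⇒normal P∈
    ... | v , nv , refl = v , nonzero⇒supp (c (emb v)) (represents nv) (subst (_≢ 0) (represents nv) c≢0)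
    A : Adapted (Supp f)
    A = adapted (suc n) (Supp f) (supp? f)
    -- The linear dimension of the desired subspace, one more than the projective one; its
    -- codimension in F^(n+1) is `k`.
    bound = suc ((n ∸ suc k) + 1)
    bound+k : bound + k ≡ suc n
    bound+k = cong suc (trans (ℕₚ.+-assoc (n ∸ suc k) 1 k) (ℕₚ.m∸n+n≡m k<n))
    too-large : ∀ {d e} → d + e ≡ suc n → (s : Split (suc n) d e) → (∀ {v} → Supp f v → π₂ s v ≡ 𝟎) →
                (∀ y → Span (Supp f) (ι₁ s y)) → ¬ bound < d
    -- `codimension-bound` needs d ≥ 2, and smaller `d` cannot exceed `bound`. Otherwise d > bound
    -- and e ≥ k would give d + e > n + 1.
    too-large {zero}        _  _ _ _ ()
    too-large {suc zero}    _  _ _ _ (s≤s ())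
    too-large {suc (suc d)} d+e s vanish generated b<d = ℕₚ.<-irrefl (trans bound+k (sym d+e))
      (ℕₚ.+-mono-<-≤ b<d (codimension-bound f code (minimal-size represents code min) nonzero s vanish generated))
    by-dimension : Dec (d A ≤ bound) → _
    by-dimension (no d≰b) = ⊥-elim (too-large (d+e≡m A) (split A) (vanishes A) (generated A) (ℕₚ.≰⇒> d≰b))
    by-dimension (yes d≤b) =
      let _ , _ , s , vanish = enlarge-to (d+e≡m A) (ℕₚ.≤⇒≤′ d≤b)
                                 (subst (bound ≤_) bound+k (ℕₚ.m≤m+n bound k)) (split A) (vanishes A) in
      image-contains {s = s} represents vanish

theorem4p4 : (p h : ℕ) → Prime p → 1 ≤ h →
    (F : FiniteField) → FiniteField.order F ≡ p ^ h →
    (n k : ℕ) → 3 ≤ n → 1 ≤ k → k ≤ n ∸ 1 →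
    (c : Geometry.Word F p n) → Geometry.MinWeightDual F p n k c →
    Σ (Geometry.ProjSubspace F n ((n ∸ k) + 1))
    (λ S → ∀ P → Geometry.InSupp F c P → Geometry.inSpan F (proj₁ S) P ≡ true)
theorem4p4 p (suc h) p-prime _ F q≡ n (suc k) _ _ k≤n-1 c minimal =
  support-in-subspace n k (ℕₚ.≤-trans k≤n-1 (ℕₚ.m∸n≤m n 1)) c minimal
  where
  open Correspondence F (subst (p ∣_) (sym q≡) (m∣m*n (p ^ h))) {{prime⇒nonZero p-prime}}
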